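{- There is a large enough constant $C$ such that for any finite field $\mathbb{F}_q$ and degree $d$ satisfying $q > C\cdot d$, and any $\delta < 0.01$, the following holds: if $f\colon \mathbb{F}_q^2 \to \mathbb{F}_q$ passes $\mathrm{LDT}_d$ with probability at least $1-\delta$, then there is a bivariate polynomial $Q$ of total degree at most $d$ such that \[ \Pr_{x \in \mathbb{F}_q^2}[f(x) = Q(x)] \geq 1 - 2\delta. \]
   Context: For a line $\ell$ in $\mathbb{F}_q^2$, $P_\ell$ is a best-fit degree-$d$ polynomial for $f$ on $\ell$ (degree $\le d$ univariate in a parametrization of $\ell$, maximizing agreement with $f$ on $\ell$, ties broken arbitrarily). $\mathrm{LDT}_d$ picks a uniform point $a\in\mathbb{F}_q^2$ and a uniform line $\ell\ni a$ and accepts iff $P_\ell(a)=f(a)$. -}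

module Defs where

open import Level using (0ℓ)
open import Data.Nat as ℕ using (ℕ; zero; suc; _<_)
open import Data.Fin as Fin using (Fin; toℕ)
open import Data.Product using (Σ; ∃; _×_; _,_; proj₁; proj₂)
open import Data.Bool using (if_then_else_)
open import Data.Integer using (+_)
open import Data.Rational using (ℚ; _/_)
open import Relation.Nullary using (¬_; Dec; yes; no; does)
open import Relation.Binary.Definitions using (DecidableEquality)
open import Relation.Binary.PropositionalEquality
open import Algebra.Structures using (IsCommutativeRing)
open import Function.Bundles using (_↔_; Inverse)

record FiniteField : Set₁ where
  infixl 6 _+_
  infixl 7 _*_
  field
    Carrier : Set
    _+_ _*_ : Carrier → Carrier → Carrier
    -_      : Carrier → Carrier
    0# 1#   : Carrier
    isCommutativeRing : IsCommutativeRing _≡_ _+_ _*_ -_ 0# 1#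
    0≢1     : ¬ (0# ≡ 1#)
    inverse : ∀ x → ¬ (x ≡ 0#) → Σ Carrier (λ y → x * y ≡ 1#)
    size    : ℕ
    enum    : Fin size ↔ Carrier

toℚ : ℕ → ℚ
toℚ n = + n / 1

sumℕ : ∀ {n} → (Fin n → ℕ) → ℕ
sumℕ {zero}  g = 0
sumℕ {suc n} g = g Fin.zero ℕ.+ sumℕ (λ i → g (Fin.suc i))

module LDT (F : FiniteField) (d : ℕ) where
  open FiniteField F

  q : ℕ
  q = size

  _≟_ : DecidableEquality Carrier
  x ≟ y with Inverse.from enum x Fin.≟ Inverse.from enum y
  ... | yes p = yes (trans (sym (Inverse.strictlyInverseˡ enum x))
                      (trans (cong (Inverse.to enum) p) (Inverse.strictlyInverseˡ enum y)))
  ... | no ¬p = no (λ e → ¬p (cong (Inverse.from enum) e))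

  sumF : (Carrier → ℕ) → ℕ
  sumF g = sumℕ (λ i → g (Inverse.to enum i))

  countF : {P : Carrier → Set} → ((x : Carrier) → Dec (P x)) → ℕ
  countF P? = sumF (λ x → if does (P? x) then 1 else 0)

  Pt : Set
  Pt = Carrier × Carrier

  sumPt : (Pt → ℕ) → ℕ
  sumPt g = sumF (λ x → sumF (λ y → g (x , y)))

  countPt : {P : Pt → Set} → ((x : Pt) → Dec (P x)) → ℕ
  countPt P? = sumPt (λ x → if does (P? x) then 1 else 0)

  sumC : ∀ {n} → (Fin n → Carrier) → Carrier
  sumC {zero}  g = 0#
  sumC {suc n} g = g Fin.zero + sumC (λ i → g (Fin.suc i))

  pow : Carrier → ℕ → Carrier
  pow x zero    = 1#
  pow x (suc n) = x * pow x n

  UPoly : Set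
  UPoly = Fin (suc d) → Carrier

  evalU : UPoly → Carrier → Carrier
  evalU c t = sumC (λ i → c i * pow t (toℕ i))

  record BiPoly : Set where
    field
      coeff : Fin (suc d) → Fin (suc d) → Carrier
      totalDeg : ∀ i j → d < toℕ i ℕ.+ toℕ j → coeff i j ≡ 0#

  evalB : BiPoly → Pt → Carrier
  evalB Q (x , y) = sumC (λ i → sumC (λ j →
    BiPoly.coeff Q i j * (pow x (toℕ i) * pow y (toℕ j))))

  NonZeroDir : Pt → Set
  NonZeroDir b = ¬ (b ≡ (0# , 0#))

  linePt : Pt → Pt → Carrier → Pt
  linePt (a₁ , a₂) (b₁ , b₂) t = (a₁ + t * b₁ , a₂ + t * b₂)

  SameLine : Pt → Pt → Pt → Pt → Set
  SameLine a b a' b' = ∀ s → ∃ λ s' → linePt a b s ≡ linePt a' b' s'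

  module _ (f : Pt → Carrier) where

    agreeLine : Pt → Pt → UPoly → ℕ
    agreeLine a b P = countF (λ t → evalU P t ≟ f (linePt a b t))

    -- A best-fit assignment: for every line ℓ a best-fit degree-d
    -- polynomial P_ℓ (ties broken arbitrarily).  It is given on
    -- parametrizations, is best-fit for each, and represents one and the
    -- same function on the points of ℓ for all parametrizations of ℓ.
    record BestFit : Set where
      field
        P : Pt → Pt → UPoly
        best : ∀ a b → NonZeroDir b → ∀ (P' : UPoly) →
               agreeLine a b P' ℕ.≤ agreeLine a b (P a b)
        wellDefined : ∀ a b a' b' → NonZeroDir b → NonZeroDir b' →
               SameLine a b a' b' → ∀ t t' → linePt a b t ≡ linePt a' b' t' →
               evalU (P a b) t ≡ evalU (P a' b') t'

    -- Number of accepting choices of (a, b) with b ≠ 0: the point is a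
    -- (= parameter 0) and the line is through a in direction b.  Uniform
    -- (a, b ≠ 0) induces the uniform (point, line through point) distribution,
    -- so acceptance probability = ldtAccept / (q² (q² - 1)).
    ldtAccept : BestFit → ℕ
    ldtAccept B = sumPt (λ a → sumPt (λ b →
      if does (b ≟₂ (0# , 0#)) then 0
      else (if does (evalU (BestFit.P B a b) 0# ≟ f a) then 1 else 0)))
      where
        _≟₂_ : DecidableEquality Pt
        (x , y) ≟₂ (x' , y') with x ≟ x' | y ≟ y'
        ... | yes refl | yes refl = yes refl
        ... | no ne | _ = no (λ e → ne (cong proj₁ e))
        ... | _ | no ne = no (λ e → ne (cong proj₂ e))

    ldtTotal : ℕ
    ldtTotal = (q ℕ.* q) ℕ.* (q ℕ.* q ℕ.∸ 1)

    agreePlane : BiPoly → ℕ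
    agreePlane Q = countPt (λ x → f x ≟ evalB Q x)

-- Let E and N be bivariate polynomials such that E · C_x = N on every line x of one
-- parallel class, where C_x is the polynomial assigned to that line; counting
-- coefficients, E can be taken of degree about 3q/5 across the lines and 2d along
-- them.  Then f · E = N at nearly all points, so P_ℓ · E = N holds identically on
-- nearly all lines ℓ.  Around a point a with E(a) ≠ 0 the power series N / E has a
-- degree-k coefficient along direction b that is a polynomial of degree ≤ k in b;
-- on a good line through a this series is P_ℓ, so its part of degree ≤ d is a
-- bivariate polynomial Q that agrees with f except on less than about a fifth of
-- the plane.  The second moment of the number of disagreements between f and Q on
-- a random line then improves this to 2δ.
module Submission where

-- `E` and `N` fit every line of the chosen direction exactly, corrupted ones included, so no set of
-- reliable lines has to be found. With degree `e` across and `s` along there are (e + 1)(d + 2s +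
-- 2) unknowns against q(d + s + 1) conditions. More unknowns than conditions means e + 1 > q/2 for
-- every `s`, so a degree linear in q is built into the scheme; s = 2d keeps `s` negligible and `e`
-- near 3q/5. Two losses follow. A line is conclusive only when more than d + e + s of its
-- parameters satisfy the identity, and the centre `a` must avoid the zeros of `E`. With q > 150d
-- each loss costs a factor 50/19, and the resulting share 72/361 of disagreements stays just below
-- 1/5. Lines are never objects of their own. Counts run over parametrizations (a, b) with b
-- nonzero, where each line occurs q(q - 1) times. For fixed t the map (a, b) to (a + tb, b) is a
-- bijection, so the rejections at parameter 0 also count the errors at every other parameter. The
-- estimates are inequalities between natural numbers; δ enters through 100 Rej ≤ q²(q² - 1) and
-- returns only in the last step.

open import Defs
open import Data.Nat using (ℕ)

-- Finite sums of natural numbers and indicators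

module Sums where
  open import Data.Bool using (if_then_else_)
  open import Data.Nat using (ℕ; zero; suc; _+_; _*_; _≤_; z≤n; s≤s)
  import Data.Nat.Properties as ℕₚ
  open import Data.Fin as Fin using (Fin)
  open import Data.Product using (_×_; proj₁; proj₂)
  open import Data.Sum using (_⊎_; inj₁; inj₂)
  open import Data.Empty using (⊥-elim)
  open import Relation.Nullary using (¬_; Dec; yes; no; does)
  open import Relation.Nullary.Decidable using (¬?)
  open import Relation.Binary.PropositionalEquality


  -- `sumℕ`, `sumF` and `sumPt` all obey these three laws, so the derived rules are proved once for
  -- sums over indices, field and plane. Rewriting under a sum comes from `mono` by antisymmetry,
  -- without function extensionality.
  record IsSum {A : Set} (∑ : (A → ℕ) → ℕ) : Set where
    field
      mono  : ∀ {g h} → (∀ x → g x ≤ h x) → ∑ g ≤ ∑ h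
      plus  : ∀ g h → ∑ (λ x → g x + h x) ≡ ∑ g + ∑ h
      scale : ∀ c g → ∑ (λ x → c * g x) ≡ c * ∑ g

    congr : ∀ {g h} → (∀ x → g x ≡ h x) → ∑ g ≡ ∑ h
    congr e = ℕₚ.≤-antisym (mono (λ x → ℕₚ.≤-reflexive (e x))) (mono (λ x → ℕₚ.≤-reflexive (sym (e x))))

    scaleʳ : ∀ c g → ∑ (λ x → g x * c) ≡ ∑ g * c
    scaleʳ c g = trans (congr (λ x → ℕₚ.*-comm (g x) c)) (trans (scale c g) (ℕₚ.*-comm c (∑ g)))

    swap : ∀ {n} (g : A → Fin n → ℕ) →
           ∑ (λ x → sumℕ (g x)) ≡ sumℕ (λ i → ∑ (λ x → g x i))
    swap {zero}  g = scale 0 (λ _ → 0)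
    swap {suc n} g = trans (plus (λ x → g x Fin.zero) _)
      (cong (∑ (λ x → g x Fin.zero) +_) (swap (λ x i → g x (Fin.suc i))))

  open IsSum

  IsSum-sumℕ : ∀ {n} → IsSum (sumℕ {n})
  IsSum-sumℕ .mono {g} {h} = go g h
    where
    go : ∀ {n} (g h : Fin n → ℕ) → (∀ i → g i ≤ h i) → sumℕ g ≤ sumℕ h
    go {zero}  g h le = z≤n
    go {suc n} g h le = ℕₚ.+-mono-≤ (le Fin.zero) (go _ _ (λ i → le (Fin.suc i)))
  IsSum-sumℕ .plus = go
    where
    open import Data.Nat.Tactic.RingSolver using (solve-∀)
    interchange : ∀ a b c d → (a + b) + (c + d) ≡ (a + c) + (b + d)
    interchange = solve-∀
    go : ∀ {n} (g h : Fin n → ℕ) → sumℕ (λ i → g i + h i) ≡ sumℕ g + sumℕ h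
    go {zero}  g h = refl
    go {suc n} g h = trans (cong (g Fin.zero + h Fin.zero +_) (go (λ i → g (Fin.suc i)) (λ i → h (Fin.suc i))))
      (interchange (g Fin.zero) (h Fin.zero) _ _)
  IsSum-sumℕ .scale = go
    where
    go : ∀ {n} c (g : Fin n → ℕ) → sumℕ (λ i → c * g i) ≡ c * sumℕ g
    go {zero}  c g = sym (ℕₚ.*-zeroʳ c)
    go {suc n} c g = trans (cong (c * g Fin.zero +_) (go c (λ i → g (Fin.suc i))))
      (sym (ℕₚ.*-distribˡ-+ c (g Fin.zero) _))

  sumℕ-const : ∀ n c → sumℕ {n} (λ _ → c) ≡ n * c
  sumℕ-const zero    c = refl
  sumℕ-const (suc n) c = cong (c +_) (sumℕ-const n c)

  -- Turns agreement of two polynomials at the first m elements of the enumerated field into a lower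
  -- bound for the number of all their agreements.
  sumℕ-initial : ∀ {n m} (le : m ≤ n) (g : Fin n → ℕ) → (∀ i → 1 ≤ g (Fin.inject≤ i le)) → m ≤ sumℕ g
  sumℕ-initial {m = zero} le g _ = z≤n
  sumℕ-initial {suc n} {suc m} (s≤s le) g pos =
    ℕₚ.+-mono-≤ (pos Fin.zero) (sumℕ-initial le (λ i → g (Fin.suc i)) (λ i → pos (Fin.suc i)))

  sumℕ-permute : ∀ {n} (g : Fin n → ℕ) (σ τ : Fin n → Fin n) → (∀ i → σ (τ i) ≡ i) → (∀ i → τ (σ i) ≡ i) →
                 sumℕ (λ i → g (σ i)) ≡ sumℕ g
  sumℕ-permute g σ τ στ τσ = trans (toSum (λ i → g (σ i))) (trans (sym (S.∑-permute g (permutation σ τ στ τσ))) (sym (toSum g)))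
    where
    open import Data.Fin.Permutation using (permutation)
    import Algebra.Properties.CommutativeMonoid.Sum ℕₚ.+-0-commutativeMonoid as S
    toSum : ∀ {n} (g : Fin n → ℕ) → sumℕ g ≡ S.sum g
    toSum {zero}  g = refl
    toSum {suc n} g = cong (g Fin.zero +_) (toSum (λ i → g (Fin.suc i)))

  ind : ∀ {A : Set} → Dec A → ℕ
  ind a? = if does a? then 1 else 0

  ind-yes : ∀ {A : Set} (a? : Dec A) → A → ind a? ≡ 1
  ind-yes (yes _) a = refl
  ind-yes (no ¬a) a = ⊥-elim (¬a a)

  ind-no : ∀ {A : Set} (a? : Dec A) → ¬ A → ind a? ≡ 0
  ind-no (yes a) ¬a = ⊥-elim (¬a a)
  ind-no (no _) ¬a = refl

  ind-≤1 : ∀ {A : Set} (a? : Dec A) → ind a? ≤ 1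
  ind-≤1 (yes _) = s≤s z≤n
  ind-≤1 (no _)  = z≤n

  ind-mono : ∀ {A B : Set} (a? : Dec A) (b? : Dec B) → (A → B) → ind a? ≤ ind b?
  ind-mono (yes a) b? i = ℕₚ.≤-reflexive (sym (ind-yes b? (i a)))
  ind-mono (no _)  b? i = z≤n

  ind-⊎ : ∀ {A B C : Set} (a? : Dec A) (b? : Dec B) (c? : Dec C) → (A → B ⊎ C) → ind a? ≤ ind b? + ind c?
  ind-⊎ (no _)  b? c? i = z≤n
  ind-⊎ (yes a) b? c? i with i a
  ... | inj₁ b = ℕₚ.≤-trans (ℕₚ.≤-reflexive (sym (ind-yes b? b))) (ℕₚ.m≤m+n _ _)
  ... | inj₂ c = ℕₚ.≤-trans (ℕₚ.≤-reflexive (sym (ind-yes c? c))) (ℕₚ.m≤n+m _ _)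

  ind-¬ : ∀ {A : Set} (a? : Dec A) → ind a? + ind (¬? a?) ≡ 1
  ind-¬ (yes _) = refl
  ind-¬ (no _)  = refl

  ind-× : ∀ {A B C : Set} (c? : Dec C) (a? : Dec A) (b? : Dec B) → (C → A × B) → (A → B → C) → ind c? ≡ ind a? * ind b?
  ind-× c? (no ¬a) b? to _ = ind-no c? (λ c → ¬a (proj₁ (to c)))
  ind-× c? (yes a) (no ¬b) to _ = ind-no c? (λ c → ¬b (proj₂ (to c)))
  ind-× c? (yes a) (yes b) _ from = ind-yes c? (from a b)

  ind² : ∀ {A : Set} (a? : Dec A) → ind a? * ind a? ≡ ind a?
  ind² (yes _) = refl
  ind² (no _)  = refl

-- Numerical estimates

module Arithmetic where
  open import Data.Nat using (ℕ; zero; suc; _+_; _*_; _∸_; _/_; _%_; _≤_; _<_; z≤n; s≤s; NonZero; >-nonZero)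
  open import Data.Nat.Properties
  open import Data.Nat.DivMod using (m≡m%n+[m/n]*n; m%n<n)
  open import Data.Nat.Tactic.RingSolver using (solve-∀)
  open import Data.Product using (_×_; _,_; ∃)
  open import Data.Sum using (_⊎_; inj₁; inj₂)
  open import Data.Empty using (⊥-elim)
  open import Relation.Binary.PropositionalEquality
  open ≤-Reasoning


  -- r ≥ min(e, c − e) ≥ e (c − e) / c, without subtraction or division.
  min-quadratic : ∀ c r e → r ≡ e ⊎ c ≤ r + e → c * e ≤ c * r + e * e
  min-quadratic c r .r (inj₁ refl) = m≤m+n (c * r) (r * r)
  min-quadratic c r e (inj₂ le) with ≤-total c e
  ... | inj₁ c≤e = ≤-trans (*-monoˡ-≤ e c≤e) (m≤n+m (e * e) (c * r))
  ... | inj₂ e≤c with k , refl ← m≤n⇒∃[o]m+o≡n e≤c = begin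
      (e + k) * e                  ≡⟨ l₁ e k ⟩
      e * k + e * e                ≤⟨ +-monoˡ-≤ (e * e) (*-mono-≤ (m≤m+n e k) k≤r) ⟩
      (e + k) * r + e * e          ∎
    where
    k≤r : k ≤ r
    k≤r = +-cancelˡ-≤ e k r (≤-trans le (≤-reflexive (+-comm r e)))
    l₁ : ∀ e k → (e + k) * e ≡ e * k + e * e
    l₁ = solve-∀

  V-factor : ∀ {V q′} → suc V ≡ suc q′ * suc q′ → V ≡ q′ * suc (suc q′)
  V-factor {V} {q′} eq = suc-injective (trans eq (l q′))
    where
    l : ∀ x → suc x * suc x ≡ suc (x * suc (suc x))
    l = solve-∀

  -- With q = `suc q′`, dividing the moment inequality by q leaves c V M ≤ c Rej + V M + q′ M (M -
  -- 1). It suffices that the last two terms are at most half of c V M; since V = q′(q + 1),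
  -- cancelling q′ M turns this into the last hypothesis. The surviving half is the origin of the
  -- factor 2.
  final-bound : ∀ (c q′ V M Rej : ℕ) → .{{NonZero c}} → V ≡ q′ * suc (suc q′) →
    c * (suc q′ * (V * M)) ≤ c * (suc q′ * Rej) + suc q′ * (V * M + q′ * (M * M ∸ M)) →
    2 * (M ∸ 1) + 2 * suc (suc q′) ≤ c * suc (suc q′) → V * M ≤ 2 * Rej
  final-bound c q′ V zero Rej _ _ _ = ≤-trans (≤-reflexive (*-zeroʳ V)) z≤n
  final-bound c q′ V M@(suc k) Rej V≡ moments hyp = *-cancelˡ-≤ c (+-cancelʳ-≤ (c * (V * M)) _ _ (begin
      c * (V * M) + c * (V * M)                       ≡⟨ l₁ (c * (V * M)) ⟩
      2 * (c * (V * M))                               ≤⟨ *-monoʳ-≤ 2 moments′ ⟩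
      2 * (c * Rej + (V * M + q′ * (k * M)))          ≡⟨ l₂ c Rej V M q′ k ⟩
      c * (2 * Rej) + (q′ * M * (2 * k) + 2 * (V * M)) ≤⟨ +-monoʳ-≤ (c * (2 * Rej)) step ⟩
      c * (2 * Rej) + c * (V * M)                     ∎))
    where
    moments′ : c * (V * M) ≤ c * Rej + (V * M + q′ * (k * M))
    moments′ = *-cancelˡ-≤ (suc q′) (begin
      suc q′ * (c * (V * M))                                                  ≡⟨ l₃ (suc q′) c (V * M) ⟩
      c * (suc q′ * (V * M))                                                  ≤⟨ moments ⟩
      c * (suc q′ * Rej) + suc q′ * (V * M + q′ * (M * M ∸ M))                ≡⟨ cong (λ z → c * (suc q′ * Rej) + suc q′ * (V * M + q′ * z)) (m+n∸m≡n M (k * M)) ⟩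
      c * (suc q′ * Rej) + suc q′ * (V * M + q′ * (k * M))                    ≡⟨ l₄ c (suc q′) Rej (V * M + q′ * (k * M)) ⟩
      suc q′ * (c * Rej + (V * M + q′ * (k * M)))                             ∎)
      where
      l₃ : ∀ q c x → q * (c * x) ≡ c * (q * x)
      l₃ = solve-∀
      l₄ : ∀ c q r y → c * (q * r) + q * y ≡ q * (c * r + y)
      l₄ = solve-∀
    step : q′ * M * (2 * k) + 2 * (V * M) ≤ c * (V * M)
    step = begin
      q′ * M * (2 * k) + 2 * (V * M)                         ≡⟨ cong (λ v → q′ * M * (2 * k) + 2 * (v * M)) V≡ ⟩
      q′ * M * (2 * k) + 2 * (q′ * suc (suc q′) * M)         ≡⟨ l₅ q′ M k (suc (suc q′)) ⟩
      q′ * M * (2 * k + 2 * suc (suc q′))                    ≤⟨ *-monoʳ-≤ (q′ * M) hyp ⟩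
      q′ * M * (c * suc (suc q′))                            ≡⟨ l₆ q′ M c (suc (suc q′)) ⟩
      c * (q′ * suc (suc q′) * M)                            ≡⟨ cong (λ v → c * (v * M)) (sym V≡) ⟩
      c * (V * M)                                            ∎
      where
      l₅ : ∀ a m k b → a * m * (2 * k) + 2 * (a * b * m) ≡ a * m * (2 * k + 2 * b)
      l₅ = solve-∀
      l₆ : ∀ a m c b → a * m * (c * b) ≡ c * (a * b * m)
      l₆ = solve-∀
    l₁ : ∀ x → x + x ≡ 2 * x
    l₁ = solve-∀
    l₂ : ∀ c r v m q k → 2 * (c * r + (v * m + q * (k * m))) ≡ c * (2 * r) + (q * m * (2 * k) + 2 * (v * m))
    l₂ = solve-∀

  -- With s = 2d there are (e + 1)(5d + 2) unknown coefficients against q (3d + 1) equations,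
  -- hence the threshold 3q/5 for e + 1.
  three-fifths : ∀ q → ∃ λ e → 5 * e ≤ 3 * q × 3 * q < 5 * suc e
  three-fifths q = 3 * q / 5 , low , high
    where
    split : 3 * q ≡ 3 * q % 5 + 3 * q / 5 * 5
    split = m≡m%n+[m/n]*n (3 * q) 5
    low : 5 * (3 * q / 5) ≤ 3 * q
    low = ≤-trans (≤-reflexive (*-comm 5 (3 * q / 5))) (≤-trans (m≤n+m _ (3 * q % 5)) (≤-reflexive (sym split)))
    high : 3 * q < 5 * suc (3 * q / 5)
    high = begin-strict
      3 * q                        ≡⟨ split ⟩
      3 * q % 5 + 3 * q / 5 * 5    <⟨ +-monoˡ-< (3 * q / 5 * 5) (m%n<n (3 * q) 5) ⟩
      5 + 3 * q / 5 * 5            ≡⟨ l (3 * q / 5) ⟩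
      5 * suc (3 * q / 5)          ∎
      where
      l : ∀ x → 5 + x * 5 ≡ 5 * suc x
      l = solve-∀

  module Parameters (d q e : ℕ) (150d<q : 150 * d < q) (low : 5 * e ≤ 3 * q) (high : 3 * q < 5 * suc e) where

    s : ℕ
    s = 2 * d

    scaled : ∀ k → k ≤ 150 → k * d ≤ q
    scaled k le = ≤-trans (*-monoˡ-≤ d le) (<⇒≤ 150d<q)

    few : q * suc (d + s) < suc e * (suc s + suc (d + s))
    few = *-cancelˡ-< 5 _ _ (begin-strict
      5 * (q * suc (d + 2 * d))                     ≡⟨ l₁ q d ⟩
      15 * (q * d) + 5 * q                          ≤⟨ +-monoʳ-≤ (15 * (q * d)) (*-monoˡ-≤ q 5≤6) ⟩
      15 * (q * d) + 6 * q                          ≡⟨ l₂ q d ⟩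
      3 * q * (5 * d + 2)                           <⟨ *-monoˡ-< (5 * d + 2) {{>-nonZero (≤-trans (s≤s z≤n) (m≤n+m 2 (5 * d)))}} high ⟩
      5 * suc e * (5 * d + 2)                       ≡⟨ l₃ e d ⟩
      5 * (suc e * (suc (2 * d) + suc (d + 2 * d))) ∎)
      where
      5≤6 : 5 ≤ 6
      5≤6 = m≤n⇒m≤1+n ≤-refl
      l₁ : ∀ q d → 5 * (q * suc (d + 2 * d)) ≡ 15 * (q * d) + 5 * q
      l₁ = solve-∀
      l₂ : ∀ q d → 15 * (q * d) + 6 * q ≡ 3 * q * (5 * d + 2)
      l₂ = solve-∀
      l₃ : ∀ e d → 5 * suc e * (5 * d + 2) ≡ 5 * (suc e * (suc (2 * d) + suc (d + 2 * d)))
      l₃ = solve-∀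

    s<q : suc (d + s) ≤ q
    s<q = ≤-<-trans (*-monoˡ-≤ d {3} {150} (s≤s (s≤s (s≤s z≤n)))) 150d<q

    e<q : suc e ≤ q
    e<q = *-cancelˡ-< 5 e q (≤-<-trans low (*-monoˡ-< q {{>-nonZero (≤-trans (s≤s z≤n) 150d<q)}} {3} {5} (s≤s (s≤s (s≤s (s≤s z≤n))))))

    -- The degree d + e + s equals 3d + e, which is at most q/50 + 3q/5 = 31q/50, so a factor 19/50
    -- remains for `Z`. Asking 3d to stay below q/50 is what produces the constant 150.
    Z-small : ∀ {Z X} → q * Z ≤ (d + (e + s)) * Z + q * X → 19 * Z ≤ 50 * X
    Z-small {Z} {X} hyp = *-cancelˡ-≤ q {{>-nonZero (≤-trans (s≤s z≤n) 150d<q)}} (+-cancelʳ-≤ (31 * (q * Z)) _ _ (begin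
      q * (19 * Z) + 31 * (q * Z)                                         ≡⟨ l₁ q Z ⟩
      50 * (q * Z)                                                        ≤⟨ *-monoʳ-≤ 50 hyp ⟩
      50 * ((d + (e + 2 * d)) * Z + q * X)                                ≡⟨ l₂ d e Z q X ⟩
      q * (50 * X) + (150 * d + 10 * (5 * e)) * Z                         ≤⟨ +-monoʳ-≤ (q * (50 * X)) (*-monoˡ-≤ Z (+-mono-≤ (<⇒≤ 150d<q) (*-monoʳ-≤ 10 low))) ⟩
      q * (50 * X) + (q + 10 * (3 * q)) * Z                               ≡⟨ cong (q * (50 * X) +_) (l₃ q Z) ⟩
      q * (50 * X) + 31 * (q * Z)                                         ∎))
      where
      l₁ : ∀ q z → q * (19 * z) + 31 * (q * z) ≡ 50 * (q * z)
      l₁ = solve-∀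
      l₂ : ∀ d e z q x → 50 * ((d + (e + 2 * d)) * z + q * x) ≡ q * (50 * x) + (150 * d + 10 * (5 * e)) * z
      l₂ = solve-∀
      l₃ : ∀ q z → (q + 10 * (3 * q)) * z ≡ 31 * (q * z)
      l₃ = solve-∀

    -- The factors satisfy q - e ≥ 2q/5 and q - s ≥ 19q/20, and the product of these shares is again
    -- 19/50.
    NZ-large : ∀ {NZ} → (q ∸ e) * (q ∸ s) ≤ NZ → 19 * (q * q) ≤ 50 * NZ
    NZ-large {NZ} hyp = *-cancelˡ-≤ 2 (begin
      2 * (19 * (q * q))                       ≡⟨ l₁ q ⟩
      2 * q * (19 * q)                         ≤⟨ *-mono-≤ x y ⟩
      5 * (q ∸ e) * (20 * (q ∸ s))             ≡⟨ l₂ (q ∸ e) (q ∸ s) ⟩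
      2 * (50 * ((q ∸ e) * (q ∸ s)))           ≤⟨ *-monoʳ-≤ 2 (*-monoʳ-≤ 50 hyp) ⟩
      2 * (50 * NZ)                            ∎)
      where
      x : 2 * q ≤ 5 * (q ∸ e)
      x = begin
        2 * q               ≡⟨ sym (m+n∸n≡m (2 * q) (3 * q)) ⟩
        2 * q + 3 * q ∸ 3 * q ≤⟨ ∸-monoʳ-≤ (2 * q + 3 * q) low ⟩
        2 * q + 3 * q ∸ 5 * e ≡⟨ cong (_∸ 5 * e) (l₃ q) ⟩
        5 * q ∸ 5 * e       ≡⟨ sym (*-distribˡ-∸ 5 q e) ⟩
        5 * (q ∸ e)         ∎
        where
        l₃ : ∀ q → 2 * q + 3 * q ≡ 5 * q
        l₃ = solve-∀
      40d≤q : 20 * (2 * d) ≤ q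
      40d≤q = ≤-trans (≤-reflexive (sym (*-assoc 20 2 d))) (scaled 40 (m≤m+n 40 110))
      y : 19 * q ≤ 20 * (q ∸ s)
      y = begin
        19 * q                ≡⟨ sym (m+n∸n≡m (19 * q) q) ⟩
        19 * q + q ∸ q        ≤⟨ ∸-monoʳ-≤ (19 * q + q) 40d≤q ⟩
        19 * q + q ∸ 20 * s   ≡⟨ cong (_∸ 20 * s) (+-comm (19 * q) q) ⟩
        20 * q ∸ 20 * s       ≡⟨ sym (*-distribˡ-∸ 20 q s) ⟩
        20 * (q ∸ s)          ∎
      l₁ : ∀ q → 2 * (19 * (q * q)) ≡ 2 * q * (19 * q)
      l₁ = solve-∀
      l₂ : ∀ a b → 5 * a * (20 * b) ≡ 2 * (50 * (a * b))
      l₂ = solve-∀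

  -- The direction found by averaging has Rβ ≤ Rej / (q(q - 1)), so V Rβ ≤ (1 + 1/q) Rej, and q ≥ 2
  -- makes this at most 3/2 Rej.
  X-small : ∀ {q′ V Rβ Rej} → 1 ≤ q′ → V ≡ q′ * suc (suc q′) → suc q′ * q′ * Rβ ≤ Rej → 2 * (Rej + V * Rβ) ≤ 5 * Rej
  X-small {q′} {V} {Rβ} {Rej} pos refl hyp = begin
    2 * (Rej + q′ * suc (suc q′) * Rβ)             ≡⟨ l₁ Rej q′ Rβ ⟩
    2 * Rej + q′ * Rβ * (3 + (1 + 2 * q′))         ≤⟨ +-monoʳ-≤ (2 * Rej) (*-monoʳ-≤ (q′ * Rβ) (+-monoʳ-≤ 3 (+-monoˡ-≤ (2 * q′) pos))) ⟩
    2 * Rej + q′ * Rβ * (3 + (q′ + 2 * q′))        ≡⟨ l₂ Rej q′ Rβ ⟩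
    2 * Rej + 3 * (suc q′ * q′ * Rβ)               ≤⟨ +-monoʳ-≤ (2 * Rej) (*-monoʳ-≤ 3 hyp) ⟩
    2 * Rej + 3 * Rej                              ≡⟨ l₃ Rej ⟩
    5 * Rej                                        ∎
    where
    l₁ : ∀ r q b → 2 * (r + q * suc (suc q) * b) ≡ 2 * r + q * b * (3 + (1 + 2 * q))
    l₁ = solve-∀
    l₂ : ∀ r q b → 2 * r + q * b * (3 + (q + 2 * q)) ≡ 2 * r + 3 * (suc q * q * b)
    l₂ = solve-∀
    l₃ : ∀ r → 2 * r + 3 * r ≡ 5 * r
    l₃ = solve-∀

  -- The chain gives T ≤ 50/19 (1 + 50/19 · 5/2) Rej/N = 50 · 144/361 · Rej/N, hence T ≤ 72/361 V by
  -- the bound on `Rej`. This is below V/5 because 5 · 72 = 360 < 361, which appears here as 720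
  -- against 722.
  T-small : ∀ {N V Rej X Z NZ T} → .{{NonZero N}} → 100 * Rej ≤ N * V → 2 * X ≤ 5 * Rej → 19 * Z ≤ 50 * X →
            19 * N ≤ 50 * NZ → NZ * T ≤ Rej + Z → 5 * T ≤ V
  T-small {N} {V} {Rej} {X} {Z} {NZ} {T} hRej hX hZ hNZ hT = *-cancelˡ-≤ 144 (*-cancelˡ-≤ N (begin
    N * (144 * (5 * T))                ≤⟨ *-monoʳ-≤ N (≤-trans (≤-reflexive (sym (*-assoc 144 5 T))) (*-monoˡ-≤ T (m≤m+n 720 2))) ⟩
    N * (722 * T)                      ≡⟨ l₁ N T ⟩
    38 * T * (19 * N)                  ≤⟨ *-monoʳ-≤ (38 * T) hNZ ⟩
    38 * T * (50 * NZ)                 ≡⟨ l₂ T NZ ⟩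
    100 * (19 * (NZ * T))              ≤⟨ *-monoʳ-≤ 100 (*-monoʳ-≤ 19 hT) ⟩
    100 * (19 * (Rej + Z))             ≡⟨ cong (100 *_) (*-distribˡ-+ 19 Rej Z) ⟩
    100 * (19 * Rej + 19 * Z)          ≤⟨ *-monoʳ-≤ 100 (+-monoʳ-≤ (19 * Rej) hZ) ⟩
    100 * (19 * Rej + 50 * X)          ≡⟨ cong (λ z → 100 * (19 * Rej + z)) (*-assoc 25 2 X) ⟩
    100 * (19 * Rej + 25 * (2 * X))    ≤⟨ *-monoʳ-≤ 100 (+-monoʳ-≤ (19 * Rej) (*-monoʳ-≤ 25 hX)) ⟩
    100 * (19 * Rej + 25 * (5 * Rej))  ≡⟨ l₃ Rej ⟩
    144 * (100 * Rej)                  ≤⟨ *-monoʳ-≤ 144 hRej ⟩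
    144 * (N * V)                      ≡⟨ l₄ N V ⟩
    N * (144 * V)                      ∎))
    where
    l₁ : ∀ n t → n * (722 * t) ≡ 38 * t * (19 * n)
    l₁ = solve-∀
    l₂ : ∀ t z → 38 * t * (50 * z) ≡ 100 * (19 * (z * t))
    l₂ = solve-∀
    l₃ : ∀ r → 100 * (19 * r + 25 * (5 * r)) ≡ 144 * (100 * r)
    l₃ = solve-∀
    l₄ : ∀ n v → 144 * (n * v) ≡ n * (144 * v)
    l₄ = solve-∀

  -- Inserting M - 1 ≤ T ≤ V/5 and cancelling q + 1 reduces the claim to 2q′ + 10 ≤ 5c with c = q -
  -- d. This holds from q = 3 on; below q = 151 the hypothesis forces d = 0, which settles the
  -- smallest fields.
  slack : ∀ {d q′ c V M T} → c + d ≡ suc q′ → 150 * d < suc q′ → 1 ≤ q′ → V ≡ q′ * suc (suc q′) →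
          M ≤ 1 + T → 5 * T ≤ V → 2 * (M ∸ 1) + 2 * suc (suc q′) ≤ c * suc (suc q′)
  slack {d} {q′} {c} {V} {M} {T} c+d (s≤s 150d≤q′) 1≤q′ refl M≤ 5T≤ =
    ≤-trans (+-monoˡ-≤ (2 * suc (suc q′)) (*-monoʳ-≤ 2 (≤-trans (∸-monoˡ-≤ 1 M≤) ≤-refl))) (main q′ refl)
    where
    large : 2 * q′ + 10 ≤ 5 * c → 2 * T + 2 * suc (suc q′) ≤ c * suc (suc q′)
    large le = *-cancelˡ-≤ 5 (begin
      5 * (2 * T + 2 * suc (suc q′))                                ≡⟨ l₁ T (suc (suc q′)) ⟩
      2 * (5 * T) + 10 * suc (suc q′)                               ≤⟨ +-monoˡ-≤ (10 * suc (suc q′)) (*-monoʳ-≤ 2 5T≤) ⟩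
      2 * (q′ * suc (suc q′)) + 10 * suc (suc q′)                   ≡⟨ l₂ q′ (suc (suc q′)) ⟩
      (2 * q′ + 10) * suc (suc q′)                                  ≤⟨ *-monoˡ-≤ (suc (suc q′)) le ⟩
      5 * c * suc (suc q′)                                          ≡⟨ *-assoc 5 c (suc (suc q′)) ⟩
      5 * (c * suc (suc q′))                                        ∎)
      where
      l₁ : ∀ t n → 5 * (2 * t + 2 * n) ≡ 2 * (5 * t) + 10 * n
      l₁ = solve-∀
      l₂ : ∀ a n → 2 * (a * n) + 10 * n ≡ (2 * a + 10) * n
      l₂ = solve-∀
    enough : 5 + 5 * d ≤ 3 * q′ → 2 * q′ + 10 ≤ 5 * c
    enough le = +-cancelʳ-≤ (5 * d) _ _ (begin
      2 * q′ + 10 + 5 * d          ≡⟨ l₁ q′ d ⟩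
      2 * q′ + 5 + (5 + 5 * d)     ≤⟨ +-monoʳ-≤ (2 * q′ + 5) le ⟩
      2 * q′ + 5 + 3 * q′          ≡⟨ l₂ q′ ⟩
      5 * suc q′                   ≡⟨ cong (5 *_) (sym c+d) ⟩
      5 * (c + d)                  ≡⟨ *-distribˡ-+ 5 c d ⟩
      5 * c + 5 * d                ∎)
      where
      l₁ : ∀ a d → 2 * a + 10 + 5 * d ≡ 2 * a + 5 + (5 + 5 * d)
      l₁ = solve-∀
      l₂ : ∀ a → 2 * a + 5 + 3 * a ≡ 5 * suc a
      l₂ = solve-∀
    5d≤q′ : 5 * d ≤ q′
    5d≤q′ = ≤-trans (*-monoˡ-≤ d (m≤m+n 5 145)) 150d≤q′
    d≡0 : q′ < 150 → d ≡ 0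
    d≡0 lt = n<1⇒n≡0 (*-cancelˡ-< 150 d 1 (≤-<-trans 150d≤q′ lt))
    main : ∀ x → q′ ≡ x → 2 * T + 2 * suc (suc q′) ≤ c * suc (suc q′)
    main zero refl = ⊥-elim (n≮0 1≤q′)
    -- For q = 2 the real-number estimate fails, but 5 T ≤ 3 forces T = 0.
    main 1 refl = ≤-reflexive (cong₂ (λ t c → 2 * t + c) T≡0 (cong (_* 3) (sym c≡2)))
      where
      T≡0 : T ≡ 0
      T≡0 = n<1⇒n≡0 (*-cancelˡ-< 5 T 1 (≤-<-trans 5T≤ (m≤m+n 4 1)))
      c≡2 : c ≡ 2
      c≡2 = trans (sym (+-identityʳ c)) (trans (cong (c +_) (sym (d≡0 (m≤m+n 2 148)))) c+d)
    -- For q = 3 the general split 5 ≤ 2q′, 5d ≤ q′ fails in its first half; here d = 0 and 5 ≤ 3q′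
    -- is checked directly.
    main 2 refl = large (enough (≤-trans (≤-reflexive (cong (λ d → 5 + 5 * d) (d≡0 (m≤m+n 3 147)))) (m≤m+n 5 1)))
    main (suc (suc (suc x))) refl = large (enough (begin
      5 + 5 * d          ≤⟨ +-mono-≤ (≤-trans (m≤m+n 5 1) (*-monoʳ-≤ 2 {3} (s≤s (s≤s (s≤s z≤n))))) 5d≤q′ ⟩
      2 * q′ + q′        ≡⟨ +-comm (2 * q′) q′ ⟩
      3 * q′             ∎))

-- Transfer between natural and rational inequalities

module Rationals where
  open import Data.Nat as ℕ using (ℕ)
  import Data.Nat.Properties as ℕₚ
  open import Data.Integer as ℤ using (+_)
  import Data.Integer.Properties as ℤₚ
  open import Data.Rational
  open import Data.Rational.Properties
  import Data.Rational.Unnormalised as ℚᵘ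
  import Data.Rational.Unnormalised.Properties as ℚᵘₚ
  open import Data.Rational.Solver using (module +-*-Solver)
  open import Relation.Binary.PropositionalEquality
  open +-*-Solver


  -- `toℚ` normalises its fraction and so is stuck on a variable; the laws are proved for this
  -- unnormalised n/1 and carried back.
  ℕᵘ : ℕ → ℚᵘ.ℚᵘ
  ℕᵘ n = ℚᵘ.mkℚᵘ (+ n) 0

  toℚᵘ-toℚ : ∀ n → toℚᵘ (toℚ n) ℚᵘ.≃ ℕᵘ n
  toℚᵘ-toℚ n = toℚᵘ-fromℚᵘ (ℕᵘ n)

  toℚ-+ : ∀ m n → toℚ (m ℕ.+ n) ≡ toℚ m + toℚ n
  toℚ-+ m n = toℚᵘ-injective (ℚᵘₚ.≃-trans (toℚᵘ-toℚ (m ℕ.+ n)) (ℚᵘₚ.≃-sym (ℚᵘₚ.≃-trans (toℚᵘ-homo-+ (toℚ m) (toℚ n))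
    (ℚᵘₚ.≃-trans (ℚᵘₚ.+-cong (toℚᵘ-toℚ m) (toℚᵘ-toℚ n)) (ℚᵘ.*≡* (cong (ℤ._* (+ 1)) (cong₂ ℤ._+_ (ℤₚ.*-identityʳ (+ m)) (ℤₚ.*-identityʳ (+ n)))))))))

  toℚ-* : ∀ m n → toℚ (m ℕ.* n) ≡ toℚ m * toℚ n
  toℚ-* m n = toℚᵘ-injective (ℚᵘₚ.≃-trans (toℚᵘ-toℚ (m ℕ.* n)) (ℚᵘₚ.≃-sym (ℚᵘₚ.≃-trans (toℚᵘ-homo-* (toℚ m) (toℚ n))
    (ℚᵘₚ.≃-trans (ℚᵘₚ.*-cong (toℚᵘ-toℚ m) (toℚᵘ-toℚ n)) (ℚᵘ.*≡* (cong (ℤ._* (+ 1)) (sym (ℤₚ.pos-* m n))))))))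

  toℚ-mono-≤ : ∀ {m n} → m ℕ.≤ n → toℚ m ≤ toℚ n
  toℚ-mono-≤ {m} {n} le = toℚᵘ-cancel-≤ (ℚᵘₚ.≤-respˡ-≃ (ℚᵘₚ.≃-sym (toℚᵘ-toℚ m)) (ℚᵘₚ.≤-respʳ-≃ (ℚᵘₚ.≃-sym (toℚᵘ-toℚ n))
    (ℚᵘ.*≤* (ℤₚ.*-monoʳ-≤-nonNeg (+ 1) (ℤ.+≤+ le)))))

  toℚ-cancel-≤ : ∀ {m n} → toℚ m ≤ toℚ n → m ℕ.≤ n
  toℚ-cancel-≤ {m} {n} le with ℚᵘₚ.≤-respˡ-≃ (toℚᵘ-toℚ m) (ℚᵘₚ.≤-respʳ-≃ (toℚᵘ-toℚ n) (toℚᵘ-mono-≤ le))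
  ... | ℚᵘ.*≤* le′ = ℤₚ.drop‿+≤+ (ℤₚ.*-cancelʳ-≤-pos (+ m) (+ n) (+ 1) le′)

  toℚ-nonNeg : ∀ n → NonNegative (toℚ n)
  toℚ-nonNeg n = nonNegative (toℚ-mono-≤ {0} {n} ℕ.z≤n)

  toℚ-pos : ∀ n → 0 ℕ.< n → Positive (toℚ n)
  toℚ-pos n lt = positive (≰⇒> (λ le → ℕₚ.<⇒≱ lt (toℚ-cancel-≤ {n} {0} le)))

  complement-≤ : ∀ (δ : ℚ) (r a n : ℕ) → r ℕ.+ a ≡ n → (toℚ 1 - δ) * toℚ n ≤ toℚ a → toℚ r ≤ δ * toℚ n
  complement-≤ δ r a n eq le = begin
    toℚ r                                        ≡⟨ solve 2 (λ r a → r := (r :+ a) :- a) refl (toℚ r) (toℚ a) ⟩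
    (toℚ r + toℚ a) - toℚ a                      ≡⟨ cong (_- toℚ a) (trans (sym (toℚ-+ r a)) (cong toℚ eq)) ⟩
    toℚ n - toℚ a                                ≤⟨ +-monoʳ-≤ (toℚ n) (neg-antimono-≤ le) ⟩
    toℚ n - (toℚ 1 - δ) * toℚ n                  ≡⟨ solve 2 (λ δ n → n :- (con 1ℚ :- δ) :* n := δ :* n) refl δ (toℚ n) ⟩
    δ * toℚ n                                    ∎
    where open ≤-Reasoning

  complement-≥ : ∀ (ε : ℚ) (m a n : ℕ) → m ℕ.+ a ≡ n → toℚ m ≤ ε * toℚ n → (toℚ 1 - ε) * toℚ n ≤ toℚ a
  complement-≥ ε m a n eq le = begin
    (toℚ 1 - ε) * toℚ n                          ≡⟨ solve 2 (λ ε n → (con 1ℚ :- ε) :* n := n :- ε :* n) refl ε (toℚ n) ⟩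
    toℚ n - ε * toℚ n                            ≤⟨ +-monoʳ-≤ (toℚ n) (neg-antimono-≤ le) ⟩
    toℚ n - toℚ m                                ≡⟨ cong (_- toℚ m) (trans (cong toℚ (sym eq)) (toℚ-+ m a)) ⟩
    (toℚ m + toℚ a) - toℚ m                      ≡⟨ solve 2 (λ m a → (m :+ a) :- m := a) refl (toℚ m) (toℚ a) ⟩
    toℚ a                                        ∎
    where open ≤-Reasoning

  hundredth : ∀ (δ : ℚ) (r n : ℕ) → δ < (+ 1 / 100) → toℚ r ≤ δ * toℚ n → 100 ℕ.* r ℕ.≤ n
  hundredth δ r n δ< le = toℚ-cancel-≤ (begin
    toℚ (100 ℕ.* r)                       ≡⟨ toℚ-* 100 r ⟩
    toℚ 100 * toℚ r                       ≤⟨ *-monoˡ-≤-nonNeg (toℚ 100) (≤-trans le (*-monoʳ-≤-nonNeg (toℚ n) {{toℚ-nonNeg n}} (<⇒≤ δ<))) ⟩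
    toℚ 100 * ((+ 1 / 100) * toℚ n)       ≡⟨ sym (*-assoc (toℚ 100) (+ 1 / 100) (toℚ n)) ⟩
    toℚ 100 * (+ 1 / 100) * toℚ n         ≡⟨ *-identityˡ (toℚ n) ⟩
    toℚ n                                 ∎)
    where open ≤-Reasoning

  double-bound : ∀ (δ : ℚ) (m r N V : ℕ) → 0 ℕ.< V → V ℕ.* m ℕ.≤ 2 ℕ.* r → toℚ r ≤ δ * toℚ (N ℕ.* V) → toℚ m ≤ toℚ 2 * δ * toℚ N
  double-bound δ m r N V pos le hyp = *-cancelˡ-≤-pos (toℚ V) {{toℚ-pos V pos}} (begin
    toℚ V * toℚ m                     ≡⟨ sym (toℚ-* V m) ⟩
    toℚ (V ℕ.* m)                     ≤⟨ toℚ-mono-≤ le ⟩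
    toℚ (2 ℕ.* r)                     ≡⟨ toℚ-* 2 r ⟩
    toℚ 2 * toℚ r                     ≤⟨ *-monoˡ-≤-nonNeg (toℚ 2) hyp ⟩
    toℚ 2 * (δ * toℚ (N ℕ.* V))       ≡⟨ cong (λ z → toℚ 2 * (δ * z)) (toℚ-* N V) ⟩
    toℚ 2 * (δ * (toℚ N * toℚ V))     ≡⟨ solve 4 (λ t δ n v → t :* (δ :* (n :* v)) := v :* (t :* δ :* n)) refl (toℚ 2) δ (toℚ N) (toℚ V) ⟩
    toℚ V * (toℚ 2 * δ * toℚ N)       ∎)
    where open ≤-Reasoning

-- Field arithmetic and sums over the field

module Plane (F : FiniteField) (d : ℕ) where
  open Sums
  open import Level using (0ℓ)
  open import Data.Nat using (ℕ; zero; suc; _+_; _*_; _∸_; _≤_; _<_; z≤n; s≤s; _≤?_)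
  import Data.Nat.Properties as ℕₚ
  open import Data.Fin as Fin using (Fin; toℕ; _↑ˡ_; _↑ʳ_; combine; remQuot; splitAt; join; inject≤; finToFun; funToFin)
  import Data.Fin.Properties as Finₚ
  open import Data.Product using (∃; _×_; _,_; proj₁; proj₂)
  open import Data.Sum using (_⊎_; inj₁; inj₂)
  open import Data.Empty using (⊥-elim)
  open import Relation.Nullary using (¬_; Dec; yes; no)
  open import Relation.Nullary.Decidable using (decidable-stable; ¬?)
  open import Relation.Binary.PropositionalEquality
  open import Data.Product.Properties using (≡-dec)
  open import Relation.Binary.Definitions using (DecidableEquality)
  open import Function.Base using (_∘_)
  open import Function.Bundles using (Inverse)
  open import Algebra.Bundles using (CommutativeRing)


  open FiniteField F public renaming (_+_ to _⊕_; _*_ to _⊗_; -_ to ⊖_)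
  open LDT F d public renaming (_≟_ to infix 4 _≟_)
  open Inverse enum using (to; from)

  to-from : ∀ x → to (from x) ≡ x
  to-from = Inverse.strictlyInverseˡ enum

  from-to : ∀ i → from (to i) ≡ i
  from-to = Inverse.strictlyInverseʳ enum

  commutativeRing : CommutativeRing 0ℓ 0ℓ
  commutativeRing = record { isCommutativeRing = isCommutativeRing }

  module R = CommutativeRing commutativeRing
  import Algebra.Properties.Ring R.ring as Rₚ
  open import Algebra.Solver.Ring.NaturalCoefficients.Default R.commutativeSemiring using (solve; _:=_; _:+_; _:*_) public

  a⊕[⊖a] : ∀ a → a ⊕ ⊖ a ≡ 0#
  a⊕[⊖a] = R.-‿inverseʳ

  a⊕b⊕⊖b : ∀ a b → (a ⊕ b) ⊕ ⊖ b ≡ a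
  a⊕b⊕⊖b a b = trans (R.+-assoc a b (⊖ b)) (trans (cong (a ⊕_) (a⊕[⊖a] b)) (R.+-identityʳ a))

  a⊕⊖b⊕b : ∀ a b → (a ⊕ ⊖ b) ⊕ b ≡ a
  a⊕⊖b⊕b a b = trans (R.+-assoc a (⊖ b) b) (trans (cong (a ⊕_) (R.-‿inverseˡ b)) (R.+-identityʳ a))

  x⊕⊖y≡0⇒x≡y : ∀ x y → x ⊕ ⊖ y ≡ 0# → x ≡ y
  x⊕⊖y≡0⇒x≡y x y e = trans (sym (a⊕⊖b⊕b x y)) (trans (cong (_⊕ y) e) (R.+-identityˡ y))

  ⊕-cancelʳ : ∀ a b c → a ⊕ c ≡ b ⊕ c → a ≡ b
  ⊕-cancelʳ a b c e = trans (sym (a⊕b⊕⊖b a c)) (trans (cong (_⊕ ⊖ c) e) (a⊕b⊕⊖b b c))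

  ⊗-cancelʳ : ∀ a b c → ¬ c ≡ 0# → a ⊗ c ≡ b ⊗ c → a ≡ b
  ⊗-cancelʳ a b c c≢0 e with c⁻¹ , cc⁻¹ ← inverse c c≢0 =
    trans (sym (lem a)) (trans (cong (_⊗ c⁻¹) e) (lem b))
    where
    lem : ∀ x → (x ⊗ c) ⊗ c⁻¹ ≡ x
    lem x = trans (R.*-assoc x c c⁻¹) (trans (cong (x ⊗_) cc⁻¹) (R.*-identityʳ x))

  IsSum-sumF : IsSum sumF
  IsSum-sumF = record
    { mono  = λ le → IsSum.mono (IsSum-sumℕ {size}) (λ i → le (to i))
    ; plus  = λ g h → IsSum.plus IsSum-sumℕ (g ∘ to) (h ∘ to)
    ; scale = λ c g → IsSum.scale IsSum-sumℕ c (g ∘ to) }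

  module ΣF = IsSum IsSum-sumF

  sumF-const : ∀ c → sumF (λ _ → c) ≡ q * c
  sumF-const c = sumℕ-const q c

  sumF-permute : ∀ (σ τ : Carrier → Carrier) → (∀ x → σ (τ x) ≡ x) → (∀ x → τ (σ x) ≡ x) →
                 ∀ g → sumF (λ x → g (σ x)) ≡ sumF g
  sumF-permute σ τ στ τσ g = trans
    (IsSum.congr IsSum-sumℕ (λ i → cong g (sym (to-from (σ (to i))))))
    (sumℕ-permute (λ i → g (to i)) (λ i → from (σ (to i))) (λ i → from (τ (to i)))
      (λ i → inv σ τ στ i) (λ i → inv τ σ τσ i))
    where
    inv : ∀ (σ τ : Carrier → Carrier) → (∀ x → σ (τ x) ≡ x) → ∀ i → from (σ (to (from (τ (to i))))) ≡ i
    inv σ τ στ i = trans (cong (λ x → from (σ x)) (to-from (τ (to i))))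
      (trans (cong from (στ (to i))) (from-to i))

  sumF-single : ∀ r → sumF (λ x → ind (x ≟ r)) ≡ 1
  sumF-single r = trans (IsSum.congr IsSum-sumℕ (λ i → ℕₚ.≤-antisym
      (ind-mono (to i ≟ r) (i Fin.≟ from r) (λ e → trans (sym (from-to i)) (cong from e)))
      (ind-mono (i Fin.≟ from r) (to i ≟ r) (λ e → trans (cong to e) (to-from r)))))
    (single (from r))
    where
    single : ∀ {n} (j : Fin n) → sumℕ (λ i → ind (i Fin.≟ j)) ≡ 1
    single {suc n} Fin.zero = cong (1 +_) (trans (IsSum.congr (IsSum-sumℕ {n}) {h = λ _ → 0} (λ i → refl)) (trans (sumℕ-const n 0) (ℕₚ.*-zeroʳ n)))
    single {suc n} (Fin.suc j) = trans (IsSum.congr IsSum-sumℕ (λ i → ℕₚ.≤-antisym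
      (ind-mono (Fin.suc i Fin.≟ Fin.suc j) (i Fin.≟ j) Finₚ.suc-injective)
      (ind-mono (i Fin.≟ j) (Fin.suc i Fin.≟ Fin.suc j) (cong Fin.suc)))) (single j)

  anyF? : ∀ {P : Carrier → Set} → (∀ x → Dec (P x)) → Dec (∃ P)
  anyF? {P} P? with Finₚ.any? (λ i → P? (to i))
  ... | yes (i , p) = yes (to i , p)
  ... | no ¬p = no (λ { (x , p) → ¬p (from x , subst P (sym (to-from x)) p) })

  -- Univariate polynomials as coefficient vectors

  -- Horner's scheme: recursion on the vector suits induction better than the explicit powers in
  -- `evalU`, and `sumC≡ev` identifies the two.
  ev : ∀ {n} → (Fin n → Carrier) → Carrier → Carrier
  ev {zero}  c t = 0#
  ev {suc n} c t = c Fin.zero ⊕ t ⊗ ev (c ∘ Fin.suc) t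

  ev-cong : ∀ {n} {c c′ : Fin n → Carrier} → (∀ i → c i ≡ c′ i) → ∀ t → ev c t ≡ ev c′ t
  ev-cong {zero}  e t = refl
  ev-cong {suc n} e t = cong₂ (λ x y → x ⊕ t ⊗ y) (e Fin.zero) (ev-cong (e ∘ Fin.suc) t)

  ev-0 : ∀ n t → ev {n} (λ _ → 0#) t ≡ 0#
  ev-0 zero    t = refl
  ev-0 (suc n) t = trans (R.+-identityˡ _) (trans (cong (t ⊗_) (ev-0 n t)) (R.zeroʳ t))

  ev-⊕ : ∀ {n} (c c′ : Fin n → Carrier) t → ev (λ i → c i ⊕ c′ i) t ≡ ev c t ⊕ ev c′ t
  ev-⊕ {zero}  c c′ t = sym (R.+-identityˡ 0#)
  ev-⊕ {suc n} c c′ t = trans (cong (λ x → c Fin.zero ⊕ c′ Fin.zero ⊕ t ⊗ x) (ev-⊕ (c ∘ Fin.suc) (c′ ∘ Fin.suc) t))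
    (solve 5 (λ a b t x y → (a :+ b) :+ t :* (x :+ y) := (a :+ t :* x) :+ (b :+ t :* y)) refl _ _ _ _ _)

  ev-⊗ : ∀ {n} r (c : Fin n → Carrier) t → ev (λ i → r ⊗ c i) t ≡ r ⊗ ev c t
  ev-⊗ {zero}  r c t = sym (R.zeroʳ r)
  ev-⊗ {suc n} r c t = trans (cong (λ x → r ⊗ c Fin.zero ⊕ t ⊗ x) (ev-⊗ r (c ∘ Fin.suc) t))
    (solve 4 (λ r a t x → r :* a :+ t :* (r :* x) := r :* (a :+ t :* x)) refl _ _ _ _)

  ev-⊖ : ∀ {n} (c : Fin n → Carrier) t → ev (λ i → ⊖ c i) t ≡ ⊖ ev c t
  ev-⊖ {zero}  c t = sym Rₚ.-0#≈0#
  ev-⊖ {suc n} c t = trans (cong (λ x → ⊖ c Fin.zero ⊕ t ⊗ x) (ev-⊖ (c ∘ Fin.suc) t))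
    (trans (cong (⊖ c Fin.zero ⊕_) (sym (Rₚ.-‿distribʳ-* t _))) (Rₚ.-‿+-comm (c Fin.zero) _))

  sumC-cong : ∀ {n} {g h : Fin n → Carrier} → (∀ i → g i ≡ h i) → sumC g ≡ sumC h
  sumC-cong {zero}  e = refl
  sumC-cong {suc n} e = cong₂ _⊕_ (e Fin.zero) (sumC-cong (e ∘ Fin.suc))

  sumC-⊗ : ∀ {n} r (g : Fin n → Carrier) → sumC (λ i → r ⊗ g i) ≡ r ⊗ sumC g
  sumC-⊗ {zero}  r g = sym (R.zeroʳ r)
  sumC-⊗ {suc n} r g = trans (cong (r ⊗ g Fin.zero ⊕_) (sumC-⊗ r (g ∘ Fin.suc))) (sym (R.distribˡ r _ _))

  sumC≡ev : ∀ {n} (c : Fin n → Carrier) t → sumC (λ i → c i ⊗ pow t (toℕ i)) ≡ ev c t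
  sumC≡ev {zero}  c t = refl
  sumC≡ev {suc n} c t = cong₂ _⊕_ (R.*-identityʳ _)
    (trans (sumC-cong (λ i → solve 3 (λ a t p → a :* (t :* p) := t :* (a :* p)) refl (c (Fin.suc i)) t (pow t (toℕ i))))
    (trans (sumC-⊗ t (λ i → c (Fin.suc i) ⊗ pow t (toℕ i))) (cong (t ⊗_) (sumC≡ev (c ∘ Fin.suc) t))))

  -- Synthetic division of c by t − r.
  quo : ∀ {n} → (Fin (suc n) → Carrier) → Carrier → Fin n → Carrier
  quo {suc n} c r Fin.zero    = ev (c ∘ Fin.suc) r
  quo {suc n} c r (Fin.suc i) = quo (c ∘ Fin.suc) r i

  -- c(t) − c(r) = (t − r) quo(t), with both sides moved so that no subtraction occurs.
  ev-quo : ∀ {n} (c : Fin (suc n) → Carrier) r t →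
           ev c t ⊕ r ⊗ ev (quo c r) t ≡ ev c r ⊕ t ⊗ ev (quo c r) t
  ev-quo {zero} c r t = solve 4 (λ a t r z → (a :+ t :* z) :+ r :* z := (a :+ r :* z) :+ t :* z) refl (c Fin.zero) t r 0#
  ev-quo {suc n} c r t = begin
    (c₀ ⊕ t ⊗ pₜ) ⊕ r ⊗ (pᵣ ⊕ t ⊗ p′)  ≡⟨ solve 6 (λ c t p r p₂ p′ → (c :+ t :* p) :+ r :* (p₂ :+ t :* p′) := (c :+ r :* p₂) :+ t :* (p :+ r :* p′)) refl c₀ t pₜ r pᵣ p′ ⟩
    (c₀ ⊕ r ⊗ pᵣ) ⊕ t ⊗ (pₜ ⊕ r ⊗ p′)  ≡⟨ cong (λ x → (c₀ ⊕ r ⊗ pᵣ) ⊕ t ⊗ x) (ev-quo (c ∘ Fin.suc) r t) ⟩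
    (c₀ ⊕ r ⊗ pᵣ) ⊕ t ⊗ (pᵣ ⊕ t ⊗ p′)  ∎
    where
    open ≡-Reasoning
    c₀ = c Fin.zero
    pₜ = ev (c ∘ Fin.suc) t
    pᵣ = ev (c ∘ Fin.suc) r
    p′ = ev (quo (c ∘ Fin.suc) r) t

  quo-zero : ∀ {n} (c : Fin (suc n) → Carrier) r → ev c r ≡ 0# → (∀ i → quo c r i ≡ 0#) → ∀ i → c i ≡ 0#
  quo-zero {zero} c r e z Fin.zero = trans (sym (trans (cong (c Fin.zero ⊕_) (R.zeroʳ r)) (R.+-identityʳ _))) e
  quo-zero {suc n} c r e z (Fin.suc i) = quo-zero (c ∘ Fin.suc) r (z Fin.zero) (z ∘ Fin.suc) i
  quo-zero {suc n} c r e z Fin.zero =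
    trans (sym (trans (cong (λ x → c Fin.zero ⊕ r ⊗ x) (z Fin.zero)) (trans (cong (c Fin.zero ⊕_) (R.zeroʳ r)) (R.+-identityʳ _)))) e

  -- If r is a root, then by `ev-quo` every other root t of c is a root of the quotient, as t - r
  -- cancels. So the quotient, with one coefficient less, loses at most one root, and induction
  -- applies.
  few-roots : ∀ {n} (c : Fin n → Carrier) → n ≤ sumF (λ t → ind (ev c t ≟ 0#)) → ∀ i → c i ≡ 0#
  few-roots {suc n} c le with anyF? (λ t → ev c t ≟ 0#)
  ... | no none = ⊥-elim (ℕₚ.<⇒≱ (s≤s z≤n) (subst (suc n ≤_) (trans (ΣF.congr (λ t → ind-no (ev c t ≟ 0#) (λ e → none (t , e))))
                    (trans (sumF-const 0) (ℕₚ.*-zeroʳ q))) le))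
  ... | yes (r , r-root) = quo-zero c r r-root (few-roots (quo c r) (ℕₚ.+-cancelˡ-≤ 1 n _ (begin
      suc n                                                                       ≤⟨ le ⟩
      sumF (λ t → ind (ev c t ≟ 0#))                                              ≤⟨ ΣF.mono (λ t → ind-⊎ (ev c t ≟ 0#) (t ≟ r) (ev (quo c r) t ≟ 0#) (split t)) ⟩
      sumF (λ t → ind (t ≟ r) + ind (ev (quo c r) t ≟ 0#))                        ≡⟨ ΣF.plus (λ t → ind (t ≟ r)) (λ t → ind (ev (quo c r) t ≟ 0#)) ⟩
      sumF (λ t → ind (t ≟ r)) + sumF (λ t → ind (ev (quo c r) t ≟ 0#))           ≡⟨ cong (_+ sumF (λ t → ind (ev (quo c r) t ≟ 0#))) (sumF-single r) ⟩
      1 + sumF (λ t → ind (ev (quo c r) t ≟ 0#))                                  ∎)))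
    where
    open ℕₚ.≤-Reasoning
    split : ∀ t → ev c t ≡ 0# → t ≡ r ⊎ ev (quo c r) t ≡ 0#
    split t t-root with ev (quo c r) t ≟ 0#
    ... | yes e = inj₂ e
    ... | no ne = inj₁ (⊗-cancelʳ t r _ ne (trans (sym (R.+-identityˡ _)) (trans (cong (_⊕ t ⊗ ev (quo c r) t) (sym r-root))
                    (trans (sym (ev-quo c r t)) (trans (cong (_⊕ r ⊗ ev (quo c r) t) t-root) (R.+-identityˡ _))))))

  identity-theorem : ∀ {n} (c c′ : Fin n → Carrier) → n ≤ sumF (λ t → ind (ev c t ≟ ev c′ t)) → ∀ i → c i ≡ c′ i
  identity-theorem c c′ le i = x⊕⊖y≡0⇒x≡y _ _ (few-roots (λ i → c i ⊕ ⊖ c′ i)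
    (ℕₚ.≤-trans le (ΣF.mono (λ t → ind-mono (ev c t ≟ ev c′ t) (ev (λ i → c i ⊕ ⊖ c′ i) t ≟ 0#)
      (λ e → trans (ev-⊕ c (λ i → ⊖ c′ i) t) (trans (cong (ev c t ⊕_) (ev-⊖ c′ t))
        (trans (cong (_⊕ ⊖ ev c′ t) e) (a⊕[⊖a] _))))))) i)

  evℕ : ℕ → (ℕ → Carrier) → Carrier → Carrier
  evℕ n c = ev {n} (c ∘ toℕ)

  evℕ-extend : ∀ n (c : ℕ → Carrier) → c n ≡ 0# → ∀ t → evℕ (suc n) c t ≡ evℕ n c t
  evℕ-extend zero    c e t = trans (cong₂ _⊕_ e (R.zeroʳ t)) (R.+-identityˡ 0#)
  evℕ-extend (suc n) c e t = cong (λ x → c 0 ⊕ t ⊗ x) (evℕ-extend n (c ∘ suc) e t)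

  evℕ-extend* : ∀ m n (c : ℕ → Carrier) → (∀ k → n ≤ k → c k ≡ 0#) → ∀ t → evℕ (m + n) c t ≡ evℕ n c t
  evℕ-extend* zero    n c z t = refl
  evℕ-extend* (suc m) n c z t = trans (evℕ-extend (m + n) c (z _ (ℕₚ.m≤n+m n m)) t) (evℕ-extend* m n c z t)

  -- Cauchy product of a polynomial with an infinite sequence. Nothing is truncated, so the same
  -- product serves for polynomials, padded by zeros, and for comparing coefficients in power series
  -- division.
  mulS : ∀ {n} → (Fin n → Carrier) → (ℕ → Carrier) → ℕ → Carrier
  mulS {zero}  p e k       = 0#
  mulS {suc n} p e zero    = p Fin.zero ⊗ e 0
  mulS {suc n} p e (suc k) = p Fin.zero ⊗ e (suc k) ⊕ mulS (p ∘ Fin.suc) e k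

  ev-mulS : ∀ {m} n (p : Fin (suc m) → Carrier) (e : ℕ → Carrier) → (∀ k → n ≤ k → e k ≡ 0#) →
            ∀ t → evℕ (m + n) (mulS p e) t ≡ ev p t ⊗ evℕ n e t
  ev-mulS {zero} n p e z t = trans (ev-cong {n} (λ i → lem (toℕ i)) t)
    (trans (ev-⊗ {n} (p Fin.zero) (e ∘ toℕ) t) (cong (_⊗ evℕ n e t) (sym (trans (cong (p Fin.zero ⊕_) (R.zeroʳ t)) (R.+-identityʳ _)))))
    where
    lem : ∀ k → mulS p e k ≡ p Fin.zero ⊗ e k
    lem zero    = refl
    lem (suc k) = R.+-identityʳ _
  ev-mulS {suc m} n p e z t = begin
    p₀ ⊗ e 0 ⊕ t ⊗ evℕ (m + n) (λ k → p₀ ⊗ e (suc k) ⊕ mulS p′ e k) t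
      ≡⟨ cong (λ x → p₀ ⊗ e 0 ⊕ t ⊗ x) (trans (ev-⊕ {m + n} _ _ t) (cong₂ _⊕_ (ev-⊗ {m + n} p₀ _ t) (ev-mulS n p′ e z t))) ⟩
    p₀ ⊗ e 0 ⊕ t ⊗ (p₀ ⊗ evℕ (m + n) (e ∘ suc) t ⊕ ev p′ t ⊗ evℕ n e t)
      ≡⟨ solve 6 (λ p e t E P f → p :* e :+ t :* (p :* E :+ P :* f) := p :* (e :+ t :* E) :+ (t :* P) :* f) refl p₀ (e 0) t _ _ _ ⟩
    p₀ ⊗ evℕ (suc (m + n)) e t ⊕ (t ⊗ ev p′ t) ⊗ evℕ n e t
      ≡⟨ cong (λ x → p₀ ⊗ x ⊕ (t ⊗ ev p′ t) ⊗ evℕ n e t) (evℕ-extend* (suc m) n e z t) ⟩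
    p₀ ⊗ evℕ n e t ⊕ (t ⊗ ev p′ t) ⊗ evℕ n e t
      ≡⟨ sym (R.distribʳ _ _ _) ⟩
    (p₀ ⊕ t ⊗ ev p′ t) ⊗ evℕ n e t ∎
    where
    open ≡-Reasoning
    p₀ = p Fin.zero
    p′ = p ∘ Fin.suc

  -- Bivariate polynomial functions of bounded degree

  -- A polynomial function is recorded by how it is built, so that closure under products,
  -- translations and substitutions is structural induction; a coefficient array is extracted only
  -- once, at degree d. `ext` makes the predicate respect pointwise equality.
  data Deg : ℕ → (Pt → Carrier) → Set where
    con  : ∀ {k} c → Deg k (λ _ → c)
    mulX : ∀ {k g} → Deg k g → Deg (suc k) (λ p → proj₁ p ⊗ g p)
    mulY : ∀ {k g} → Deg k g → Deg (suc k) (λ p → proj₂ p ⊗ g p)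
    add  : ∀ {k g h} → Deg k g → Deg k h → Deg k (λ p → g p ⊕ h p)
    ext  : ∀ {k g h} → (∀ p → g p ≡ h p) → Deg k g → Deg k h

  Deg-cast : ∀ {j k g} → j ≡ k → Deg j g → Deg k g
  Deg-cast {g = g} e = subst (λ k → Deg k g) e

  Deg-suc : ∀ {k g} → Deg k g → Deg (suc k) g
  Deg-suc (con c)   = con c
  Deg-suc (mulX D)  = mulX (Deg-suc D)
  Deg-suc (mulY D)  = mulY (Deg-suc D)
  Deg-suc (add D D′) = add (Deg-suc D) (Deg-suc D′)
  Deg-suc (ext e D) = ext e (Deg-suc D)

  Deg-+ : ∀ {k g} j → Deg k g → Deg (j + k) g
  Deg-+ zero    D = D
  Deg-+ (suc j) D = Deg-suc (Deg-+ j D)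

  Deg-≤ : ∀ {j k g} → j ≤ k → Deg j g → Deg k g
  Deg-≤ {j} {k} le D = Deg-cast (ℕₚ.m∸n+n≡m le) (Deg-+ (k ∸ j) D)

  Deg-scale : ∀ {k g} c → Deg k g → Deg k (λ p → c ⊗ g p)
  Deg-scale c (con c′)   = con (c ⊗ c′)
  Deg-scale c (mulX {g = g} D)   = ext (λ p → solve 3 (λ x c g → x :* (c :* g) := c :* (x :* g)) refl (proj₁ p) c (g p)) (mulX (Deg-scale c D))
  Deg-scale c (mulY {g = g} D)   = ext (λ p → solve 3 (λ x c g → x :* (c :* g) := c :* (x :* g)) refl (proj₂ p) c (g p)) (mulY (Deg-scale c D))
  Deg-scale c (add D D′) = ext (λ p → sym (R.distribˡ c _ _)) (add (Deg-scale c D) (Deg-scale c D′))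
  Deg-scale c (ext e D)  = ext (λ p → cong (c ⊗_) (e p)) (Deg-scale c D)

  Deg-neg : ∀ {k g} → Deg k g → Deg k (λ p → ⊖ g p)
  Deg-neg D = ext (λ p → Rₚ.-1*x≈-x _) (Deg-scale (⊖ 1#) D)

  Deg-mul : ∀ {j k g h} → Deg j g → Deg k h → Deg (j + k) (λ p → g p ⊗ h p)
  Deg-mul {j} (con c) D = Deg-scale c (Deg-+ j D)
  Deg-mul (mulX D) D′ = ext (λ p → sym (R.*-assoc _ _ _)) (mulX (Deg-mul D D′))
  Deg-mul (mulY D) D′ = ext (λ p → sym (R.*-assoc _ _ _)) (mulY (Deg-mul D D′))
  Deg-mul {h = h} (add D₁ D₂) D′ = ext (λ p → sym (R.distribʳ (h p) _ _)) (add (Deg-mul D₁ D′) (Deg-mul D₂ D′))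
  Deg-mul {h = h} (ext e D) D′ = ext (λ p → cong (_⊗ h p) (e p)) (Deg-mul D D′)

  _⊞_ : Pt → Pt → Pt
  (x , y) ⊞ (x′ , y′) = (x ⊕ x′ , y ⊕ y′)

  Deg-translate : ∀ {k g} v → Deg k g → Deg k (λ p → g (p ⊞ v))
  Deg-translate v (con c) = con c
  Deg-translate v (mulX D) = ext (λ p → sym (R.distribʳ _ _ _)) (add (mulX (Deg-translate v D)) (Deg-suc (Deg-scale (proj₁ v) (Deg-translate v D))))
  Deg-translate v (mulY D) = ext (λ p → sym (R.distribʳ _ _ _)) (add (mulY (Deg-translate v D)) (Deg-suc (Deg-scale (proj₂ v) (Deg-translate v D))))
  Deg-translate v (add D D′) = add (Deg-translate v D) (Deg-translate v D′)
  Deg-translate v (ext e D)  = ext (λ p → e (p ⊞ v)) (Deg-translate v D)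

  Deg-ev : ∀ {n k} {c : Fin (suc n) → Pt → Carrier} {l : Pt → Carrier} → (∀ i → Deg k (c i)) → Deg 1 l →
           Deg (n + k) (λ p → ev (λ i → c i p) (l p))
  Deg-ev {zero}  Dc Dl = ext (λ p → sym (trans (cong (_ ⊕_) (R.zeroʳ _)) (R.+-identityʳ _))) (Dc Fin.zero)
  Deg-ev {suc n} Dc Dl = add (Deg-+ (suc n) (Dc Fin.zero)) (Deg-mul Dl (Deg-ev (λ i → Dc (Fin.suc i)) Dl))

  Deg-sumC : ∀ {n k} {c : Fin n → Pt → Carrier} → (∀ i → Deg k (c i)) → Deg k (λ p → sumC (λ i → c i p))
  Deg-sumC {zero}  D = con 0#
  Deg-sumC {suc n} D = add (D Fin.zero) (Deg-sumC (λ i → D (Fin.suc i)))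

  evB : (ℕ → ℕ → Carrier) → Pt → Carrier
  evB c (x , y) = evℕ (suc d) (λ i → evℕ (suc d) (c i) y) x

  -- The bound k ≤ d keeps the square array from overflowing: multiplying by a coordinate shifts it
  -- by one, and what is pushed over the edge has index sum at least d, above the previous degree,
  -- hence is zero.
  coefficients : ∀ {k g} → Deg k g → k ≤ d →
    ∃ λ (c : ℕ → ℕ → Carrier) → (∀ i j → k < i + j → c i j ≡ 0#) × (∀ p → evB c p ≡ g p)
  coefficients {k} (con a) _ = c , c-zero , λ { (x , y) → trans
      (cong₂ (λ u v → u ⊕ x ⊗ v)
        (trans (cong (λ v → a ⊕ y ⊗ v) (ev-0 d y)) (trans (cong (a ⊕_) (R.zeroʳ y)) (R.+-identityʳ a)))
        (trans (ev-cong {d} (λ _ → ev-0 (suc d) y) x) (ev-0 d x)))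
      (trans (cong (a ⊕_) (R.zeroʳ x)) (R.+-identityʳ a)) }
    where
    c : ℕ → ℕ → Carrier
    c zero    zero    = a
    c zero    (suc j) = 0#
    c (suc i) j       = 0#
    c-zero : ∀ i j → k < i + j → c i j ≡ 0#
    c-zero zero    (suc j) lt = refl
    c-zero (suc i) j       lt = refl
  coefficients {suc k} (mulX {g = g} D) k<d with coefficients D (ℕₚ.<⇒≤ k<d)
  ... | c , c-zero , c-eq = c′ , c′-zero , λ { (x , y) → trans
      (cong₂ _⊕_ (ev-0 (suc d) y)
        (cong (x ⊗_) (sym (evℕ-extend d (λ i → evℕ (suc d) (c i) y)
          (trans (ev-cong {suc d} (λ j → c-zero d (toℕ j) (ℕₚ.≤-trans k<d (ℕₚ.m≤m+n d (toℕ j)))) y) (ev-0 (suc d) y)) x))))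
      (trans (R.+-identityˡ _) (cong (x ⊗_) (c-eq (x , y)))) }
    where
    c′ : ℕ → ℕ → Carrier
    c′ zero    j = 0#
    c′ (suc i) j = c i j
    c′-zero : ∀ i j → suc k < i + j → c′ i j ≡ 0#
    c′-zero zero    j lt       = refl
    c′-zero (suc i) j (s≤s lt) = c-zero i j lt
  coefficients {suc k} (mulY {g = g} D) k<d with coefficients D (ℕₚ.<⇒≤ k<d)
  ... | c , c-zero , c-eq = c′ , c′-zero , λ { (x , y) → trans
      (ev-cong {suc d} (λ i → trans (R.+-identityˡ _) (cong (y ⊗_) (sym (evℕ-extend d (c (toℕ i))
        (c-zero (toℕ i) d (ℕₚ.≤-trans k<d (ℕₚ.m≤n+m d (toℕ i)))) y)))) x)
      (trans (ev-⊗ {suc d} y (λ i → evℕ (suc d) (c (toℕ i)) y) x) (cong (y ⊗_) (c-eq (x , y)))) }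
    where
    c′ : ℕ → ℕ → Carrier
    c′ i zero    = 0#
    c′ i (suc j) = c i j
    c′-zero : ∀ i j → suc k < i + j → c′ i j ≡ 0#
    c′-zero i zero    lt = refl
    c′-zero i (suc j) lt = c-zero i j (ℕₚ.≤-pred (subst (suc (suc k) ≤_) (ℕₚ.+-suc i j) lt))
  coefficients (add D D′) le with coefficients D le | coefficients D′ le
  ... | c , c-zero , c-eq | c′ , c′-zero , c′-eq =
    (λ i j → c i j ⊕ c′ i j) ,
    (λ i j lt → trans (cong₂ _⊕_ (c-zero i j lt) (c′-zero i j lt)) (R.+-identityˡ 0#)) ,
    λ { (x , y) → trans (ev-cong {suc d} (λ i → ev-⊕ {suc d} (λ j → c (toℕ i) (toℕ j)) (λ j → c′ (toℕ i) (toℕ j)) y) x)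
        (trans (ev-⊕ {suc d} (λ i → evℕ (suc d) (c (toℕ i)) y) (λ i → evℕ (suc d) (c′ (toℕ i)) y) x) (cong₂ _⊕_ (c-eq (x , y)) (c′-eq (x , y)))) }
  coefficients (ext e D) le with coefficients D le
  ... | c , c-zero , c-eq = c , c-zero , λ p → trans (c-eq p) (e p)

  toBiPoly : ∀ {g} → Deg d g → ∃ λ (Q : BiPoly) → ∀ p → evalB Q p ≡ g p
  toBiPoly D with coefficients D ℕₚ.≤-refl
  ... | c , c-zero , c-eq = record { coeff = λ i j → c (toℕ i) (toℕ j) ; totalDeg = λ i j → c-zero (toℕ i) (toℕ j) } ,
    λ { (x , y) → trans (trans
      (sumC-cong {suc d} (λ i → trans (sumC-cong {suc d} (λ j →
          solve 3 (λ c x y → c :* (x :* y) := x :* (c :* y)) refl (c (toℕ i) (toℕ j)) (pow x (toℕ i)) (pow y (toℕ j))))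
        (trans (sumC-⊗ {suc d} (pow x (toℕ i)) (λ j → c (toℕ i) (toℕ j) ⊗ pow y (toℕ j)))
        (trans (R.*-comm _ _) (cong (_⊗ pow x (toℕ i)) (sumC≡ev {suc d} (λ j → c (toℕ i) (toℕ j)) y))))))
      (sumC≡ev {suc d} (λ i → evℕ (suc d) (c (toℕ i)) y) x)) (c-eq (x , y)) }

  -- Expansion along the lines through a point and division of power series

  -- The Taylor coefficients of g at a, as functions of the direction b. That the k-th one has
  -- degree at most k in b is what lets data collected line by line fit together into one bivariate
  -- polynomial.
  record Expansion (K : ℕ) (a : Pt) (g : Pt → Carrier) : Set where
    field
      co      : ℕ → Pt → Carrier
      co-Deg  : ∀ k → Deg k (co k)
      co-zero : ∀ b k → suc K ≤ k → co k b ≡ 0#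
      co-eq   : ∀ b t → g (linePt a b t) ≡ evℕ (suc K) (λ k → co k b) t

  module _ (a : Pt) where
    open Expansion

    -- On the line the factor becomes l(a) + t l(b), so coefficient k becomes l(a) c_k + l(b)
    -- c_(k-1), and its degree in b rises by one together with the index. The two coordinates are
    -- the instances.
    expand-linear : ∀ {K g} (l : Pt → Carrier) → (∀ {k h} → Deg k h → Deg (suc k) (λ p → l p ⊗ h p)) →
      (∀ b t → l (linePt a b t) ≡ l a ⊕ t ⊗ l b) → Expansion K a g → Expansion (suc K) a (λ p → l p ⊗ g p)
    expand-linear {K} l mul-l l-linear X = record { co = co′ ; co-Deg = deg ; co-zero = zer ; co-eq = eqn }
      where
      co′ : ℕ → Pt → Carrier
      co′ zero    b = l a ⊗ co X 0 b
      co′ (suc k) b = l a ⊗ co X (suc k) b ⊕ l b ⊗ co X k b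
      deg : ∀ k → Deg k (co′ k)
      deg zero    = Deg-scale (l a) (co-Deg X 0)
      deg (suc k) = add (Deg-scale (l a) (co-Deg X (suc k))) (mul-l (co-Deg X k))
      zer : ∀ b k → suc (suc K) ≤ k → co′ k b ≡ 0#
      zer b (suc k) (s≤s le) = trans (cong₂ (λ u v → l a ⊗ u ⊕ l b ⊗ v) (co-zero X b (suc k) (ℕₚ.m≤n⇒m≤1+n le)) (co-zero X b k le))
        (trans (cong₂ _⊕_ (R.zeroʳ _) (R.zeroʳ _)) (R.+-identityˡ 0#))
      eqn : ∀ b t → _ ≡ evℕ (suc (suc K)) (λ k → co′ k b) t
      eqn b t = sym (begin
        l a ⊗ x₀ ⊕ t ⊗ evℕ (suc K) (λ k → l a ⊗ co X (suc k) b ⊕ l b ⊗ co X k b) t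
          ≡⟨ cong (λ u → l a ⊗ x₀ ⊕ t ⊗ u) (trans (ev-⊕ {suc K} (λ i → l a ⊗ co X (suc (toℕ i)) b) (λ i → l b ⊗ co X (toℕ i) b) t)
            (cong₂ _⊕_ (ev-⊗ {suc K} (l a) (λ i → co X (suc (toℕ i)) b) t) (ev-⊗ {suc K} (l b) (λ i → co X (toℕ i) b) t))) ⟩
        l a ⊗ x₀ ⊕ t ⊗ (l a ⊗ x₁ ⊕ l b ⊗ x)
          ≡⟨ solve 6 (λ la x₀ t x₁ lb x → la :* x₀ :+ t :* (la :* x₁ :+ lb :* x) := la :* (x₀ :+ t :* x₁) :+ (t :* lb) :* x) refl (l a) x₀ t x₁ (l b) x ⟩
        l a ⊗ evℕ (suc (suc K)) (λ k → co X k b) t ⊕ (t ⊗ l b) ⊗ x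
          ≡⟨ cong (λ u → l a ⊗ u ⊕ (t ⊗ l b) ⊗ x) (evℕ-extend (suc K) (λ k → co X k b) (co-zero X b (suc K) ℕₚ.≤-refl) t) ⟩
        l a ⊗ x ⊕ (t ⊗ l b) ⊗ x
          ≡⟨ sym (R.distribʳ x _ _) ⟩
        (l a ⊕ t ⊗ l b) ⊗ x
          ≡⟨ cong₂ _⊗_ (sym (l-linear b t)) (sym (co-eq X b t)) ⟩
        _ ∎)
        where
        open ≡-Reasoning
        x₀ = co X 0 b
        x₁ = evℕ (suc K) (λ k → co X (suc k) b) t
        x  = evℕ (suc K) (λ k → co X k b) t

    expand : ∀ {K g} → Deg K g → Expansion K a g
    expand {K} (con c) = record { co = co′ ; co-Deg = deg ; co-zero = zer
      ; co-eq = λ b t → sym (trans (cong (λ u → c ⊕ t ⊗ u) (ev-0 K t)) (trans (cong (c ⊕_) (R.zeroʳ t)) (R.+-identityʳ c))) }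
      where
      co′ : ℕ → Pt → Carrier
      co′ zero    b = c
      co′ (suc k) b = 0#
      deg : ∀ k → Deg k (co′ k)
      deg zero    = con c
      deg (suc k) = con 0#
      zer : ∀ b k → suc K ≤ k → co′ k b ≡ 0#
      zer b (suc k) _ = refl
    expand (mulX D) = expand-linear proj₁ mulX (λ _ _ → refl) (expand D)
    expand (mulY D) = expand-linear proj₂ mulY (λ _ _ → refl) (expand D)
    expand {K} (add D D′) = record
      { co = λ k b → co X k b ⊕ co X′ k b
      ; co-Deg = λ k → add (co-Deg X k) (co-Deg X′ k)
      ; co-zero = λ b k le → trans (cong₂ _⊕_ (co-zero X b k le) (co-zero X′ b k le)) (R.+-identityˡ 0#)
      ; co-eq = λ b t → trans (cong₂ _⊕_ (co-eq X b t) (co-eq X′ b t)) (sym (ev-⊕ {suc K} (λ i → co X (toℕ i) b) (λ i → co X′ (toℕ i) b) t)) }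
      where
      X  = expand D
      X′ = expand D′
    expand (ext e D) = record { co = co X ; co-Deg = co-Deg X ; co-zero = co-zero X
      ; co-eq = λ b t → trans (sym (e _)) (co-eq X b t) }
      where X = expand D

  -- Quotient of two power series in t whose coefficients are polynomials in b. The constant term of
  -- the divisor must be the same unit `ε` for all b: dividing by it is then multiplication by the
  -- constant `ι`, and the quotient stays polynomial in b.
  module Series (e : ℕ → Pt → Carrier) (e-Deg : ∀ k → Deg k (e k)) (ε ι : Carrier) (ει : ε ⊗ ι ≡ 1#) (e₀ : ∀ b → e 0 b ≡ ε) where

    -- One step of long division: with p₀ = ι n₀ the difference n - p₀ e has no constant term, and
    -- it is shifted down by one.
    next : (ℕ → Pt → Carrier) → ℕ → Pt → Carrier
    next n k b = n (suc k) b ⊕ ⊖ ((ι ⊗ n 0 b) ⊗ e (suc k) b)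

    series : (ℕ → Pt → Carrier) → ℕ → Pt → Carrier
    series n zero    b = ι ⊗ n 0 b
    series n (suc k) b = series (next n) k b

    -- `s` counts the division steps already made. After them the remainder has degree s + k at
    -- place k; p₀ has degree s, and its product with coefficient k + 1 of the divisor has degree s
    -- + k + 1, matching the shift.
    series-Deg : ∀ s n → (∀ k → Deg (s + k) (n k)) → ∀ k → Deg (s + k) (series n k)
    series-Deg s n D zero    = Deg-scale ι (D 0)
    series-Deg s n D (suc k) = Deg-cast (sym (ℕₚ.+-suc s k)) (series-Deg (suc s) (next n)
      (λ j → add (Deg-cast (ℕₚ.+-suc s j) (D (suc j)))
        (Deg-neg (Deg-cast (trans (ℕₚ.+-assoc s 0 (suc j)) (ℕₚ.+-suc s j)) (Deg-mul (Deg-scale ι (D 0)) (e-Deg (suc j)))))) k)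

    -- The constant terms force p₀ = ι n₀, and removing p₀ leaves the same problem for the shifted
    -- remainder. This is how the polynomial of a good line is recognised as the start of the
    -- series.
    series-unique : ∀ {m} (p : Fin m → Carrier) n b → (∀ k → k < m → mulS p (λ j → e j b) k ≡ n k b) →
                    ∀ i → p i ≡ series n (toℕ i) b
    series-unique {suc m} p n b eq = λ { Fin.zero → head ; (Fin.suc i) → series-unique (p ∘ Fin.suc) (next n) b tail i }
      where
      open ≡-Reasoning
      head : p Fin.zero ≡ ι ⊗ n 0 b
      head = begin
        p Fin.zero               ≡⟨ sym (R.*-identityʳ _) ⟩
        p Fin.zero ⊗ 1#          ≡⟨ cong (p Fin.zero ⊗_) (sym ει) ⟩
        p Fin.zero ⊗ (ε ⊗ ι)     ≡⟨ solve 3 (λ p e i → p :* (e :* i) := i :* (p :* e)) refl _ _ _ ⟩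
        ι ⊗ (p Fin.zero ⊗ ε)     ≡⟨ cong (λ u → ι ⊗ (p Fin.zero ⊗ u)) (sym (e₀ b)) ⟩
        ι ⊗ (p Fin.zero ⊗ e 0 b) ≡⟨ cong (ι ⊗_) (eq 0 (s≤s z≤n)) ⟩
        ι ⊗ n 0 b                ∎
      tail : ∀ k → k < m → mulS (p ∘ Fin.suc) (λ j → e j b) k ≡ next n k b
      tail k lt = begin
        mulS (p ∘ Fin.suc) (λ j → e j b) k
          ≡⟨ sym (a⊕b⊕⊖b _ _) ⟩
        (mulS (p ∘ Fin.suc) (λ j → e j b) k ⊕ p Fin.zero ⊗ e (suc k) b) ⊕ ⊖ (p Fin.zero ⊗ e (suc k) b)
          ≡⟨ cong (_⊕ ⊖ (p Fin.zero ⊗ e (suc k) b)) (trans (R.+-comm _ _) (eq (suc k) (s≤s lt))) ⟩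
        n (suc k) b ⊕ ⊖ (p Fin.zero ⊗ e (suc k) b)
          ≡⟨ cong (λ u → n (suc k) b ⊕ ⊖ (u ⊗ e (suc k) b)) head ⟩
        next n k b ∎

  ev-1# : ∀ {n} (c : Fin n → Carrier) → ev c 1# ≡ sumC c
  ev-1# {zero}  c = refl
  ev-1# {suc n} c = cong (c Fin.zero ⊕_) (trans (R.*-identityˡ _) (ev-1# (c ∘ Fin.suc)))

  linePt-0 : ∀ a b → linePt a b 0# ≡ a
  linePt-0 a b = cong₂ _,_ (lem _ _) (lem _ _)
    where
    lem : ∀ x y → x ⊕ 0# ⊗ y ≡ x
    lem x y = trans (cong (x ⊕_) (R.zeroˡ y)) (R.+-identityʳ x)

  -- Q(a + b) is the sum of the first d + 1 coefficients of N / E along a + t b.  Comparing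
  -- with P at t = 1 only makes homogeneity of these coefficients in b unnecessary.
  module _ {K E N} (DE : Deg K E) (DN : Deg (d + K) N) (a : Pt) (Ea≢0 : ¬ E a ≡ 0#) where
    open Expansion

    private
      XE : Expansion K a E
      XE = expand a DE
      XN : Expansion (d + K) a N
      XN = expand a DN

      e n : ℕ → Pt → Carrier
      e = co XE
      n = co XN

      e₀ : ∀ b → e 0 b ≡ E a
      e₀ b = sym (trans (cong E (sym (linePt-0 a b))) (trans (co-eq XE b 0#)
        (trans (cong (e 0 b ⊕_) (R.zeroˡ _)) (R.+-identityʳ _))))

      open Series e (co-Deg XE) (E a) (proj₁ (inverse (E a) Ea≢0)) (proj₂ (inverse (E a) Ea≢0)) e₀

      -- Along the line both sides have degree at most d + K in t, so d + K + 1 agreements make all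
      -- their coefficients equal. Those of index at most d already determine the d + 1 coefficients
      -- of `P`.
      coeffs : ∀ b (P : UPoly) → suc (d + K) ≤ sumF (λ t → ind (evalU P t ⊗ E (linePt a b t) ≟ N (linePt a b t))) →
               ∀ k → k < suc d → mulS P (λ j → e j b) k ≡ n k b
      coeffs b P many k lt = subst (λ j → mulS P (λ j → e j b) j ≡ n j b) (Finₚ.toℕ-fromℕ< k<)
        (identity-theorem {suc (d + K)} (λ i → mulS P (λ j → e j b) (toℕ i)) (λ i → n (toℕ i) b)
          (ℕₚ.≤-trans many (ΣF.mono (λ t → ind-mono (evalU P t ⊗ E (linePt a b t) ≟ N (linePt a b t))
            (evℕ (suc (d + K)) (mulS P (λ j → e j b)) t ≟ evℕ (suc (d + K)) (λ j → n j b) t)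
            (λ eq → trans (trans (cong (λ m → evℕ m (mulS P (λ j → e j b)) t) (sym (ℕₚ.+-suc d K)))
              (trans (ev-mulS (suc K) P (λ j → e j b) (co-zero XE b) t)
                (cong₂ _⊗_ (sym (sumC≡ev P t)) (sym (co-eq XE b t)))))
              (trans eq (co-eq XN b t))))))
          (Fin.fromℕ< k<))
        where
        k< : k < suc (d + K)
        k< = ℕₚ.≤-trans lt (s≤s (ℕₚ.m≤m+n d K))

    reconstruct : ∃ λ (Q : BiPoly) → ∀ b (P : UPoly) →
        suc (d + K) ≤ sumF (λ t → ind (evalU P t ⊗ E (linePt a b t) ≟ N (linePt a b t))) →
        evalB Q (b ⊞ a) ≡ evalU P 1#
    -- The series coefficients are functions of the direction b; the translation by -a makes them
    -- functions of the point a + b.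
    reconstruct with toBiPoly (Deg-translate (⊖ proj₁ a , ⊖ proj₂ a) (Deg-sumC {suc d}
          (λ i → Deg-≤ (Finₚ.toℕ≤pred[n] i) (series-Deg 0 n (co-Deg XN) (toℕ i)))))
    ... | Q , Q-eq = Q , λ b P many → begin
        evalB Q (b ⊞ a)                           ≡⟨ Q-eq (b ⊞ a) ⟩
        sumC {suc d} (λ i → series n (toℕ i) ((b ⊞ a) ⊞ (⊖ proj₁ a , ⊖ proj₂ a)))
          ≡⟨ sumC-cong {suc d} (λ i → cong (series n (toℕ i)) (cong₂ _,_ (a⊕b⊕⊖b (proj₁ b) (proj₁ a)) (a⊕b⊕⊖b (proj₂ b) (proj₂ a)))) ⟩
        sumC {suc d} (λ i → series n (toℕ i) b)   ≡⟨ sumC-cong {suc d} (λ i → sym (series-unique P n b (coeffs b P many) i)) ⟩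
        sumC P                                    ≡⟨ sym (ev-1# P) ⟩
        ev P 1#                                   ≡⟨ sym (sumC≡ev P 1#) ⟩
        evalU P 1#                                ∎
      where open ≡-Reasoning

  2≤q : 2 ≤ q
  2≤q = two (from 0#) (from 1#) (λ e → 0≢1 (trans (sym (to-from 0#)) (trans (cong to e) (to-from 1#))))
    where
    two : ∀ {n} (i j : Fin n) → ¬ i ≡ j → 2 ≤ n
    two {suc zero}    Fin.zero Fin.zero ne = ⊥-elim (ne refl)
    two {suc (suc n)} i j ne = s≤s (s≤s z≤n)

  anyPt? : ∀ {P : Pt → Set} → (∀ p → Dec (P p)) → Dec (∃ P)
  anyPt? P? with anyF? (λ x → anyF? (λ y → P? (x , y)))
  ... | yes (x , y , p) = yes ((x , y) , p)
  ... | no ¬p = no (λ { ((x , y) , p) → ¬p (x , y , p) })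

  -- Interpolating one univariate polynomial per field element

  ev₂ : ∀ {m n} → (Fin m → Fin n → Carrier) → Carrier → Carrier → Carrier
  ev₂ c x t = ev (λ i → ev (c i) t) x

  ev₂-swap : ∀ {m n} (c : Fin m → Fin n → Carrier) x t → ev₂ c x t ≡ ev (λ j → ev (λ i → c i j) x) t
  ev₂-swap {zero}  {n} c x t = sym (ev-0 n t)
  ev₂-swap {suc m} {n} c x t = trans (cong (λ u → ev (c Fin.zero) t ⊕ x ⊗ u) (ev₂-swap (c ∘ Fin.suc) x t))
    (trans (cong (ev (c Fin.zero) t ⊕_) (sym (ev-⊗ {n} x (λ j → ev (λ i → c (Fin.suc i) j) x) t))) (sym (ev-⊕ {n} (c Fin.zero) _ t)))

  ev₂-⊕ : ∀ {m n} (c c′ : Fin m → Fin n → Carrier) x t → ev₂ (λ i j → c i j ⊕ c′ i j) x t ≡ ev₂ c x t ⊕ ev₂ c′ x t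
  ev₂-⊕ {m} c c′ x t = trans (ev-cong {m} (λ i → ev-⊕ (c i) (c′ i) t) x) (ev-⊕ {m} (λ i → ev (c i) t) (λ i → ev (c′ i) t) x)

  ev₂-⊖ : ∀ {m n} (c : Fin m → Fin n → Carrier) x t → ev₂ (λ i j → ⊖ c i j) x t ≡ ⊖ ev₂ c x t
  ev₂-⊖ {m} c x t = trans (ev-cong {m} (λ i → ev-⊖ (c i) t) x) (ev-⊖ {m} (λ i → ev (c i) t) x)

  ev-vanishing : ∀ {n} (c : Fin n → Carrier) → n ≤ q → (∀ t → ev c t ≡ 0#) → ∀ i → c i ≡ 0#
  ev-vanishing {n} c le z = few-roots c (ℕₚ.≤-trans le (ℕₚ.≤-reflexive (sym
    (trans (ΣF.congr (λ t → ind-yes (ev c t ≟ 0#) (z t))) (trans (sumF-const 1) (ℕₚ.*-identityʳ q))))))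

  ev₂-vanishing : ∀ {m n} (c : Fin m → Fin n → Carrier) → m ≤ q → n ≤ q → (∀ x t → ev₂ c x t ≡ 0#) → ∀ i j → c i j ≡ 0#
  ev₂-vanishing c m≤q n≤q z i = ev-vanishing (c i) n≤q (λ t → ev-vanishing (λ i → ev (c i) t) m≤q (λ x → z x t) i)

  pad : ∀ {n} → (Fin n → Carrier) → ℕ → Carrier
  pad {zero}  c k       = 0#
  pad {suc n} c zero    = c Fin.zero
  pad {suc n} c (suc k) = pad (c ∘ Fin.suc) k

  pad-toℕ : ∀ {n} (c : Fin n → Carrier) i → pad c (toℕ i) ≡ c i
  pad-toℕ c Fin.zero    = refl
  pad-toℕ c (Fin.suc i) = pad-toℕ (c ∘ Fin.suc) i

  pad-zero : ∀ {n} (c : Fin n → Carrier) k → n ≤ k → pad c k ≡ 0#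
  pad-zero {zero}  c k le = refl
  pad-zero {suc n} c (suc k) (s≤s le) = pad-zero (c ∘ Fin.suc) k le

  ev-product : ∀ {m n} (p : Fin (suc m) → Carrier) (e : Fin (suc n) → Carrier) →
               ∃ λ (c : Fin (suc (m + n)) → Carrier) → ∀ t → ev c t ≡ ev p t ⊗ ev e t
  ev-product {m} {n} p e = (λ i → mulS p (pad e) (toℕ i)) , λ t →
    trans (cong (λ k → evℕ k (mulS p (pad e)) t) (sym (ℕₚ.+-suc m n)))
    (trans (ev-mulS (suc n) p (pad e) (pad-zero e) t) (cong (ev p t ⊗_) (ev-cong {suc n} (pad-toℕ e) t)))

  agree-initial : ∀ {n} (c c′ : Fin n → Carrier) (le : n ≤ q) → (∀ i → ev c (to (inject≤ i le)) ≡ ev c′ (to (inject≤ i le))) →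
                  ∀ t → ev c t ≡ ev c′ t
  agree-initial {n} c c′ le eq = ev-cong {n} (identity-theorem c c′ (sumℕ-initial le (λ i → ind (ev c (to i) ≟ ev c′ (to i)))
    (λ i → ℕₚ.≤-reflexive (sym (ind-yes (ev c (to (inject≤ i le)) ≟ ev c′ (to (inject≤ i le))) (eq i))))))

  funToFin-cong : ∀ {m n} (f g : Fin m → Fin n) → (∀ i → f i ≡ g i) → funToFin f ≡ funToFin g
  funToFin-cong {zero}  f g e = refl
  funToFin-cong {suc m} f g e = cong₂ combine (e Fin.zero) (funToFin-cong (f ∘ Fin.suc) (g ∘ Fin.suc) (e ∘ Fin.suc))

  -- Counting replaces linear algebra: q^B < q^A, so any map collides, linear or not. The difference
  -- of two colliding vectors then plays the part of a nonzero kernel element.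
  collision : ∀ {A B} → B < A → (Φ : (Fin A → Fin q) → (Fin B → Fin q)) →
              ∃ λ u → ∃ λ v → ¬ (∀ i → u i ≡ v i) × (∀ i → Φ u i ≡ Φ v i)
  collision {A} {B} B<A Φ with Finₚ.pigeonhole (ℕₚ.^-monoʳ-< q 2≤q B<A) (λ i → funToFin (Φ (finToFun i)))
  ... | i , j , i<j , eq = finToFun i , finToFun j ,
    (λ u≗v → Finₚ.<⇒≢ i<j (trans (sym (Finₚ.funToFin-finToFin {A} i)) (trans (funToFin-cong _ _ u≗v) (Finₚ.funToFin-finToFin {A} j)))) ,
    (λ k → trans (sym (Finₚ.finToFun-funToFin (Φ (finToFun i)) k)) (trans (cong (λ z → finToFun z k) eq) (Finₚ.finToFun-funToFin (Φ (finToFun j)) k)))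

  module Interpolation (e s : ℕ) (C : Carrier → UPoly)
    (few : q * suc (d + s) < suc e * (suc s + suc (d + s))) (s<q : suc (d + s) ≤ q) (e<q : suc e ≤ q) where

    private
      Unknowns : Set
      Unknowns = Fin (suc e * (suc s + suc (d + s))) → Fin q

      Eᵤ : Unknowns → Fin (suc e) → Fin (suc s) → Carrier
      Eᵤ u i j = to (u (combine i (j ↑ˡ suc (d + s))))

      Nᵤ : Unknowns → Fin (suc e) → Fin (suc (d + s)) → Carrier
      Nᵤ u i j = to (u (combine i (suc s ↑ʳ j)))

      -- The defect C·E - N in column i, sampled at d + s + 1 values of t only. Its degree in t is
      -- at most d + s, so vanishing at the samples forces vanishing in the whole column.
      Φ : Unknowns → Fin q → Fin (suc (d + s)) → Carrier
      Φ u i j = evalU (C (to i)) t ⊗ ev₂ (Eᵤ u) (to i) t ⊕ ⊖ ev₂ (Nᵤ u) (to i) t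
        where t = to (inject≤ j s<q)

      Φᶠ : Unknowns → Fin (q * suc (d + s)) → Fin q
      Φᶠ w k = from (Φ w (proj₁ (remQuot (suc (d + s)) k)) (proj₂ (remQuot {q} (suc (d + s)) k)))

      clash : ∃ λ u → ∃ λ v → ¬ (∀ i → u i ≡ v i) × (∀ i → Φᶠ u i ≡ Φᶠ v i)
      clash = collision few Φᶠ

      u v : Unknowns
      u = proj₁ clash
      v = proj₁ (proj₂ clash)

      u≢v : ¬ (∀ i → u i ≡ v i)
      u≢v = proj₁ (proj₂ (proj₂ clash))

      Φ-eq : ∀ i j → Φ u i j ≡ Φ v i j
      Φ-eq i j = trans (sym (to-from _)) (trans (cong to (subst
          (λ ij → from (Φ u (proj₁ ij) (proj₂ ij)) ≡ from (Φ v (proj₁ ij) (proj₂ ij)))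
          (Finₚ.remQuot-combine {q} i j) (proj₂ (proj₂ (proj₂ clash)) (combine i j))))
        (to-from _))

    E : Fin (suc e) → Fin (suc s) → Carrier
    E i j = Eᵤ u i j ⊕ ⊖ Eᵤ v i j

    N : Fin (suc e) → Fin (suc (d + s)) → Carrier
    N i j = Nᵤ u i j ⊕ ⊖ Nᵤ v i j

    private
      sub : ∀ {m n} (c c′ : Fin m → Fin n → Carrier) x t → ev₂ (λ i j → c i j ⊕ ⊖ c′ i j) x t ≡ ev₂ c x t ⊕ ⊖ ev₂ c′ x t
      sub c c′ x t = trans (ev₂-⊕ c (λ i j → ⊖ c′ i j) x t) (cong (ev₂ c x t ⊕_) (ev₂-⊖ c′ x t))

      rearrange : ∀ a x y n m → a ⊗ x ⊕ ⊖ n ≡ a ⊗ y ⊕ ⊖ m → a ⊗ (x ⊕ ⊖ y) ≡ n ⊕ ⊖ m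
      rearrange a x y n m eq = ⊕-cancelʳ _ _ (a ⊗ y ⊕ ⊖ n) (begin
        a ⊗ (x ⊕ ⊖ y) ⊕ (a ⊗ y ⊕ ⊖ n)  ≡⟨ solve 5 (λ a x y′ y n′ → a :* (x :+ y′) :+ (a :* y :+ n′) := a :* ((x :+ y′) :+ y) :+ n′) refl a x (⊖ y) y (⊖ n) ⟩
        a ⊗ ((x ⊕ ⊖ y) ⊕ y) ⊕ ⊖ n      ≡⟨ cong (λ z → a ⊗ z ⊕ ⊖ n) (a⊕⊖b⊕b x y) ⟩
        a ⊗ x ⊕ ⊖ n                    ≡⟨ eq ⟩
        a ⊗ y ⊕ ⊖ m                    ≡⟨ sym (a⊕b⊕⊖b _ n) ⟩
        ((a ⊗ y ⊕ ⊖ m) ⊕ n) ⊕ ⊖ n      ≡⟨ solve 4 (λ z m′ n n′ → ((z :+ m′) :+ n) :+ n′ := (n :+ m′) :+ (z :+ n′)) refl (a ⊗ y) (⊖ m) n (⊖ n) ⟩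
        (n ⊕ ⊖ m) ⊕ (a ⊗ y ⊕ ⊖ n)      ∎)
        where open ≡-Reasoning

      grid : ∀ i j → evalU (C (to i)) (to (inject≤ j s<q)) ⊗ ev₂ E (to i) (to (inject≤ j s<q)) ≡ ev₂ N (to i) (to (inject≤ j s<q))
      grid i j = trans (cong (evalU (C (to i)) t ⊗_) (sub (Eᵤ u) (Eᵤ v) (to i) t))
        (trans (rearrange _ _ _ _ _ (Φ-eq i j)) (sym (sub (Nᵤ u) (Nᵤ v) (to i) t)))
        where t = to (inject≤ j s<q)

      column : ∀ i t → evalU (C (to i)) t ⊗ ev₂ E (to i) t ≡ ev₂ N (to i) t
      column i t = begin
        evalU (C x) t ⊗ ev₂ E x t    ≡⟨ sym (lhs t) ⟩
        ev (proj₁ prod) t            ≡⟨ agree-initial (proj₁ prod) nₓ s<q (λ j → trans (lhs _) (trans (grid i j) (ev₂-swap N x _))) t ⟩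
        ev nₓ t                      ≡⟨ sym (ev₂-swap N x t) ⟩
        ev₂ N x t                    ∎
        where
        open ≡-Reasoning
        x : Carrier
        x = to i
        eₓ : Fin (suc s) → Carrier
        eₓ j = ev (λ i → E i j) x
        nₓ : Fin (suc (d + s)) → Carrier
        nₓ j = ev (λ i → N i j) x
        prod : ∃ λ (c : Fin (suc (d + s)) → Carrier) → ∀ t → ev c t ≡ ev (C x) t ⊗ ev eₓ t
        prod = ev-product (C x) eₓ
        lhs : ∀ t → ev (proj₁ prod) t ≡ evalU (C x) t ⊗ ev₂ E x t
        lhs t = trans (proj₂ prod t) (cong₂ _⊗_ (sym (sumC≡ev (C x) t)) (sym (ev₂-swap E x t)))

    equation : ∀ x t → evalU (C x) t ⊗ ev₂ E x t ≡ ev₂ N x t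
    equation x t = subst (λ x → evalU (C x) t ⊗ ev₂ E x t ≡ ev₂ N x t) (to-from x) (column (from x) t)

    -- If `E` vanished as a function, so would `N` by `equation`. Both have degree below q in each
    -- variable, so all their coefficients would be zero and the two colliding vectors would
    -- coincide.
    nonvanishing : ∃ λ (p : Pt) → ¬ ev₂ E (proj₁ p) (proj₂ p) ≡ 0#
    nonvanishing with anyPt? (λ p → ¬? (ev₂ E (proj₁ p) (proj₂ p) ≟ 0#))
    ... | yes found = found
    ... | no none   = ⊥-elim (u≢v same)
      where
      E-zero : ∀ x t → ev₂ E x t ≡ 0#
      E-zero x t = decidable-stable (ev₂ E x t ≟ 0#) (λ ne → none ((x , t) , ne))
      N-zero : ∀ x t → ev₂ N x t ≡ 0#
      N-zero x t = trans (sym (equation x t)) (trans (cong (evalU (C x) t ⊗_) (E-zero x t)) (R.zeroʳ _))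
      to-injective : ∀ {i j} → to i ≡ to j → i ≡ j
      to-injective {i} {j} eq = trans (sym (from-to i)) (trans (cong from eq) (from-to j))
      same′ : ∀ i z → u (combine i (join (suc s) (suc (d + s)) z)) ≡ v (combine i (join (suc s) (suc (d + s)) z))
      same′ i (inj₁ j) = to-injective (x⊕⊖y≡0⇒x≡y _ _ (ev₂-vanishing E e<q (ℕₚ.≤-trans (s≤s (ℕₚ.m≤n+m s d)) s<q) E-zero i j))
      same′ i (inj₂ j) = to-injective (x⊕⊖y≡0⇒x≡y _ _ (ev₂-vanishing N e<q s<q N-zero i j))
      same : ∀ k → u k ≡ v k
      same k = subst (λ k → u k ≡ v k) (trans (cong (combine i) (Finₚ.join-splitAt (suc s) (suc (d + s)) j)) (Finₚ.combine-remQuot {suc e} _ k))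
        (same′ i (splitAt (suc s) j))
        where
        i : Fin (suc e)
        i = proj₁ (remQuot (suc s + suc (d + s)) k)
        j : Fin (suc s + suc (d + s))
        j = proj₂ (remQuot {suc e} (suc s + suc (d + s)) k)

  -- Sums over the plane, averaging and counting nonzeros

  IsSum-sumPt : IsSum sumPt
  IsSum-sumPt = record
    { mono  = λ le → ΣF.mono (λ x → ΣF.mono (λ y → le (x , y)))
    ; plus  = λ g h → trans (ΣF.congr (λ x → ΣF.plus (λ y → g (x , y)) (λ y → h (x , y))))
                (ΣF.plus (λ x → sumF (λ y → g (x , y))) (λ x → sumF (λ y → h (x , y))))
    ; scale = λ c g → trans (ΣF.congr (λ x → ΣF.scale c (λ y → g (x , y)))) (ΣF.scale c (λ x → sumF (λ y → g (x , y)))) }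

  module ΣP = IsSum IsSum-sumPt

  sumPt-const : ∀ c → sumPt (λ _ → c) ≡ q * q * c
  sumPt-const c = trans (ΣF.congr (λ _ → sumF-const c)) (trans (sumF-const (q * c)) (sym (ℕₚ.*-assoc q q c)))

  sumF-1 : sumF (λ _ → 1) ≡ q
  sumF-1 = trans (sumF-const 1) (ℕₚ.*-identityʳ q)

  sumPt-sumF : ∀ (g : Pt → Carrier → ℕ) → sumPt (λ p → sumF (g p)) ≡ sumF (λ t → sumPt (λ p → g p t))
  sumPt-sumF g = ΣP.swap {q} (λ p i → g p (to i))

  sumPt-sumPt : ∀ (g : Pt → Pt → ℕ) → sumPt (λ p → sumPt (g p)) ≡ sumPt (λ b → sumPt (λ p → g p b))
  sumPt-sumPt g = trans (sumPt-sumF (λ p x → sumF (λ y → g p (x , y)))) (ΣF.congr (λ x → sumPt-sumF (λ p y → g p (x , y))))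

  sumPt-permute : ∀ (σ τ σ′ τ′ : Carrier → Carrier) → (∀ x → σ (τ x) ≡ x) → (∀ x → τ (σ x) ≡ x) →
    (∀ x → σ′ (τ′ x) ≡ x) → (∀ x → τ′ (σ′ x) ≡ x) → ∀ g → sumPt (λ p → g (σ (proj₁ p) , σ′ (proj₂ p))) ≡ sumPt g
  sumPt-permute σ τ σ′ τ′ e₁ e₂ e₃ e₄ g = trans
    (ΣF.congr (λ x → sumF-permute σ′ τ′ e₃ e₄ (λ y → g (σ x , y))))
    (sumF-permute σ τ e₁ e₂ (λ x → sumF (λ y → g (x , y))))

  sumPt-translate : ∀ v g → sumPt (λ p → g (p ⊞ v)) ≡ sumPt g
  sumPt-translate (v₁ , v₂) = sumPt-permute (_⊕ v₁) (_⊕ ⊖ v₁) (_⊕ v₂) (_⊕ ⊖ v₂)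
    (λ x → a⊕⊖b⊕b x v₁) (λ x → a⊕b⊕⊖b x v₁) (λ x → a⊕⊖b⊕b x v₂) (λ x → a⊕b⊕⊖b x v₂)

  scaling : ∀ c → ¬ c ≡ 0# → ∃ λ c⁻¹ → (∀ x → c ⊗ (c⁻¹ ⊗ x) ≡ x) × (∀ x → c⁻¹ ⊗ (c ⊗ x) ≡ x)
  scaling c c≢0 with c⁻¹ , e ← inverse c c≢0 = c⁻¹ , inv c c⁻¹ e , inv c⁻¹ c (trans (R.*-comm c⁻¹ c) e)
    where
    inv : ∀ a b → a ⊗ b ≡ 1# → ∀ x → a ⊗ (b ⊗ x) ≡ x
    inv a b e x = trans (sym (R.*-assoc a b x)) (trans (cong (_⊗ x) e) (R.*-identityˡ x))

  _•_ : Carrier → Pt → Pt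
  c • (x , y) = (c ⊗ x , c ⊗ y)

  sumPt-scale : ∀ c → ¬ c ≡ 0# → ∀ g → sumPt (λ p → g (c • p)) ≡ sumPt g
  sumPt-scale c c≢0 with c⁻¹ , e , e′ ← scaling c c≢0 = sumPt-permute (c ⊗_) (c⁻¹ ⊗_) (c ⊗_) (c⁻¹ ⊗_) e e′ e e′

  infix 4 _≟₂_
  _≟₂_ : DecidableEquality Pt
  _≟₂_ = ≡-dec _≟_ _≟_

  O : Pt
  O = (0# , 0#)

  sumPt-single : ∀ v → sumPt (λ p → ind (p ≟₂ v)) ≡ 1
  sumPt-single (v₁ , v₂) = trans
    (ΣF.congr {h = λ x → ind (x ≟ v₁)} (λ x → trans (ΣF.congr (λ y → ind-× ((x , y) ≟₂ (v₁ , v₂)) (x ≟ v₁) (y ≟ v₂) (λ e → cong proj₁ e , cong proj₂ e) (cong₂ _,_)))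
      (trans (ΣF.scale (ind (x ≟ v₁)) (λ y → ind (y ≟ v₂)))
        (trans (cong (ind (x ≟ v₁) *_) (sumF-single v₂)) (ℕₚ.*-identityʳ (ind (x ≟ v₁)))))))
    (sumF-single v₁)

  nz : Pt → ℕ
  nz b = ind (¬? (b ≟₂ O))

  V : ℕ
  V = sumPt nz

  1+V : suc V ≡ q * q
  1+V = begin
    1 + V                                              ≡⟨ cong (_+ V) (sym (sumPt-single O)) ⟩
    sumPt (λ b → ind (b ≟₂ O)) + V                     ≡⟨ sym (ΣP.plus (λ b → ind (b ≟₂ O)) nz) ⟩
    sumPt (λ b → ind (b ≟₂ O) + nz b)                  ≡⟨ ΣP.congr (λ b → ind-¬ (b ≟₂ O)) ⟩
    sumPt (λ _ → 1)                                    ≡⟨ trans (sumPt-const 1) (ℕₚ.*-identityʳ _) ⟩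
    q * q                                              ∎
    where open ≡-Reasoning

  -- If `φ` exceeded T / W at every point of positive weight, the weighted sum would exceed `T`.
  -- Positive weight is part of the result because the weights are indicators of a condition that
  -- the chosen direction or centre must satisfy.
  average : ∀ (w φ : Pt → ℕ) T → sumPt (λ p → w p * φ p) ≤ T → 0 < sumPt w →
            ∃ λ p → 0 < w p × sumPt w * φ p ≤ T
  average w φ T le pos with anyPt? (λ p → (1 ≤? w p) ×-dec (sumPt w * φ p ≤? T))
    where open import Relation.Nullary.Decidable using (_×-dec_)
  ... | yes found = found
  ... | no none   = ⊥-elim (ℕₚ.<⇒≱ (ℕₚ.m<m+n (W * T) pos) (begin
      W * T + W                                ≡⟨ trans (ℕₚ.+-comm (W * T) W) (sym (ℕₚ.*-suc W T)) ⟩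
      W * suc T                                ≡⟨ sym (ΣP.scaleʳ (suc T) w) ⟩
      sumPt (λ p → w p * suc T)                ≤⟨ ΣP.mono large ⟩
      sumPt (λ p → W * (w p * φ p))            ≡⟨ ΣP.scale W (λ p → w p * φ p) ⟩
      W * sumPt (λ p → w p * φ p)              ≤⟨ ℕₚ.*-monoʳ-≤ W le ⟩
      W * T                                    ∎))
    where
    open ℕₚ.≤-Reasoning
    W = sumPt w
    large : ∀ p → w p * suc T ≤ W * (w p * φ p)
    large p with w p in eq
    ... | zero  = z≤n
    ... | suc n = ℕₚ.≤-trans (ℕₚ.*-monoʳ-≤ (suc n) (ℕₚ.≰⇒> (λ le′ → none (p , subst (1 ≤_) (sym eq) (s≤s z≤n) , le′))))
        (ℕₚ.≤-reflexive (x∙yz≈y∙xz (suc n) W (φ p)))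
      where open import Algebra.Properties.CommutativeSemigroup ℕₚ.*-commutativeSemigroup using (x∙yz≈y∙xz)

  many-nonroots : ∀ {n} (c : Fin (suc n) → Carrier) → (∃ λ t → ¬ ev c t ≡ 0#) → q ∸ n ≤ sumF (λ t → ind (¬? (ev c t ≟ 0#)))
  many-nonroots {n} c (t₀ , ne) = ℕₚ.m≤n+o⇒m∸n≤o q n (begin
    q                                                                         ≡⟨ sym sumF-1 ⟩
    sumF (λ _ → 1)                                                            ≡⟨ ΣF.congr (λ t → sym (ind-¬ (ev c t ≟ 0#))) ⟩
    sumF (λ t → ind (ev c t ≟ 0#) + ind (¬? (ev c t ≟ 0#)))                   ≡⟨ ΣF.plus (λ t → ind (ev c t ≟ 0#)) (λ t → ind (¬? (ev c t ≟ 0#))) ⟩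
    sumF (λ t → ind (ev c t ≟ 0#)) + sumF (λ t → ind (¬? (ev c t ≟ 0#)))      ≤⟨ ℕₚ.+-monoˡ-≤ _ few ⟩
    n + sumF (λ t → ind (¬? (ev c t ≟ 0#)))                                   ∎)
    where
    open ℕₚ.≤-Reasoning
    few : sumF (λ t → ind (ev c t ≟ 0#)) ≤ n
    few with suc n ≤? sumF (λ t → ind (ev c t ≟ 0#))
    ... | yes le = ⊥-elim (ne (trans (ev-cong {suc n} (few-roots c le) t₀) (ev-0 (suc n) t₀)))
    ... | no nle = ℕₚ.≤-pred (ℕₚ.≰⇒> nle)

  -- At a value t₀ with a nonzero entry the polynomial in x has at most m roots, and each remaining
  -- x gives a nonzero polynomial in t with at most n roots.
  many-nonroots₂ : ∀ {m n} (c : Fin (suc m) → Fin (suc n) → Carrier) → (∃ λ (p : Pt) → ¬ ev₂ c (proj₁ p) (proj₂ p) ≡ 0#) →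
    (q ∸ m) * (q ∸ n) ≤ sumPt (λ p → ind (¬? (ev₂ c (proj₁ p) (proj₂ p) ≟ 0#)))
  many-nonroots₂ {m} {n} c ((x₀ , t₀) , ne) = begin
    (q ∸ m) * (q ∸ n)                                                ≤⟨ ℕₚ.*-monoˡ-≤ (q ∸ n) (many-nonroots (λ i → ev (c i) t₀) (x₀ , ne)) ⟩
    sumF (λ x → ind (¬? (ev₂ c x t₀ ≟ 0#))) * (q ∸ n)                ≡⟨ sym (ΣF.scaleʳ (q ∸ n) (λ x → ind (¬? (ev₂ c x t₀ ≟ 0#)))) ⟩
    sumF (λ x → ind (¬? (ev₂ c x t₀ ≟ 0#)) * (q ∸ n))                ≤⟨ ΣF.mono row ⟩
    sumPt (λ p → ind (¬? (ev₂ c (proj₁ p) (proj₂ p) ≟ 0#)))          ∎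
    where
    open ℕₚ.≤-Reasoning
    row : ∀ x → ind (¬? (ev₂ c x t₀ ≟ 0#)) * (q ∸ n) ≤ sumF (λ t → ind (¬? (ev₂ c x t ≟ 0#)))
    row x with ev₂ c x t₀ ≟ 0#
    ... | yes _ = z≤n
    ... | no ne′ = ℕₚ.≤-trans (ℕₚ.≤-reflexive (ℕₚ.*-identityˡ _))
        (ℕₚ.≤-trans (many-nonroots (λ j → ev (λ i → c i j) x) (t₀ , λ e → ne′ (trans (ev₂-swap c x t₀) e)))
          (ΣF.mono (λ t → ind-mono (¬? (ev (λ j → ev (λ i → c i j) x) t ≟ 0#)) (¬? (ev₂ c x t ≟ 0#)) (λ ne e → ne (trans (sym (ev₂-swap c x t)) e)))))

-- Acceptance and rejection counts of the test

module Test (F : FiniteField) (d : ℕ) (f : LDT.Pt F d → FiniteField.Carrier F) (B : LDT.BestFit F d f) where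
  open Sums
  open Arithmetic
  open Plane F d
  open import Data.Nat using (ℕ; zero; suc; _+_; _*_; _∸_; _≤_; _<_; z≤n; s≤s; _≤?_; NonZero; >-nonZero)
  import Data.Nat.Properties as ℕₚ
  open import Data.Nat.Tactic.RingSolver using (solve-∀)
  open import Data.Fin as Fin using (Fin; toℕ)
  open import Data.Product using (Σ; ∃; _×_; _,_; proj₁; proj₂)
  open import Data.Sum using (_⊎_; inj₁; inj₂)
  open import Data.Empty using (⊥-elim)
  open import Relation.Nullary using (¬_; Dec; yes; no)
  open import Relation.Nullary.Decidable using (¬?)
  open import Relation.Binary.PropositionalEquality
  open import Function.Bundles using (Inverse)
  open Inverse enum using (to; from)
  open BestFit B using (P; wellDefined)


  -- Starting the line at its point of parameter t is the reparametrization s to s - t, and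
  -- `wellDefined` makes the value depend on the point alone. Thus an error at any parameter is a
  -- rejection at some base point.
  on-line : ∀ a b t → ¬ b ≡ O → evalU (P a b) t ≡ evalU (P (linePt a b t) b) 0#
  on-line a b t b≢0 = wellDefined a b (linePt a b t) b b≢0 b≢0
    (λ s → s ⊕ ⊖ t , cong₂ _,_ (lem _ _ s) (lem _ _ s)) t 0# (sym (linePt-0 (linePt a b t) b))
    where
    lem : ∀ x y s → x ⊕ s ⊗ y ≡ (x ⊕ t ⊗ y) ⊕ (s ⊕ ⊖ t) ⊗ y
    lem x y s = trans (cong (λ z → x ⊕ z ⊗ y) (sym (a⊕⊖b⊕b s t)))
      (solve 5 (λ x y s t t′ → x :+ ((s :+ t′) :+ t) :* y := (x :+ t :* y) :+ (s :+ t′) :* y) refl x y s t (⊖ t))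

  miss : Pt → Pt → Carrier → ℕ
  miss a b t = ind (¬? (evalU (P a b) t ≟ f (linePt a b t)))

  rej : Pt → Pt → ℕ
  rej a b = nz b * ind (¬? (evalU (P a b) 0# ≟ f a))

  err : Pt → Pt → Carrier → ℕ
  err a b t = nz b * miss a b t

  Rej : ℕ
  Rej = sumPt (λ a → sumPt (λ b → rej a b))

  err≡rej : ∀ a b t → err a b t ≡ rej (linePt a b t) b
  err≡rej a b t with b ≟₂ O
  ... | yes _  = refl
  ... | no b≢0 = cong (λ u → 1 * ind (¬? (u ≟ f (linePt a b t)))) (on-line a b t b≢0)

  sum-rej-swap : sumPt (λ b → sumPt (λ a → rej a b)) ≡ Rej
  sum-rej-swap = sumPt-sumPt (λ b a → rej a b)

  -- For fixed b and t the translation of a by t b permutes the plane, so errors at parameter t are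
  -- as frequent as at parameter 0, where the test looks.
  sum-err : ∀ t → sumPt (λ a → sumPt (λ b → err a b t)) ≡ Rej
  sum-err t = begin
    sumPt (λ a → sumPt (λ b → err a b t))                  ≡⟨ ΣP.congr (λ a → ΣP.congr (λ b → err≡rej a b t)) ⟩
    sumPt (λ a → sumPt (λ b → rej (linePt a b t) b))       ≡⟨ sumPt-sumPt (λ a b → rej (linePt a b t) b) ⟩
    sumPt (λ b → sumPt (λ a → rej (linePt a b t) b))       ≡⟨ ΣP.congr (λ b → sumPt-translate (t • b) (λ a → rej a b)) ⟩
    sumPt (λ b → sumPt (λ a → rej a b))                    ≡⟨ sum-rej-swap ⟩
    Rej                                                    ∎
    where open ≡-Reasoning

  sumPt²-sumF : ∀ (g : Pt → Pt → Carrier → ℕ) →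
    sumPt (λ a → sumPt (λ b → sumF (g a b))) ≡ sumF (λ t → sumPt (λ a → sumPt (λ b → g a b t)))
  sumPt²-sumF g = trans (ΣP.congr (λ a → sumPt-sumF (g a))) (sumPt-sumF (λ a t → sumPt (λ b → g a b t)))

  sum-sum-err : sumPt (λ a → sumPt (λ b → sumF (err a b))) ≡ q * Rej
  sum-sum-err = trans (sumPt²-sumF err) (trans (ΣF.congr sum-err) (sumF-const Rej))

  -- The decision procedure inside ldtAccept has no name, so its summand is obtained by unification.
  accept-sum : Σ (Fin q → Fin q → Fin q → Fin q → ℕ) λ acc →
    ldtAccept f B ≡ sumℕ (λ i → sumℕ (λ j → sumℕ (λ k → sumℕ (λ l → acc i j k l))))
  accept-sum = _ , refl

  acc : Pt → Pt → ℕ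
  acc a b = nz b * ind (evalU (P a b) 0# ≟ f a)

  accept≡ : ldtAccept f B ≡ sumPt (λ a → sumPt (λ b → acc a b))
  accept≡ = trans (proj₂ accept-sum) (Σn.congr (λ i → Σn.congr (λ j → Σn.congr (λ k → Σn.congr (λ l → summand i j k l)))))
    where
    module Σn = IsSum (IsSum-sumℕ {q})
    zero-direction : ∀ i j k l → (to k , to l) ≡ O → proj₁ accept-sum i j k l ≡ 0
    zero-direction i j k l e with to k ≟ 0# | to l ≟ 0#
    ... | no ne | _     = ⊥-elim (ne (cong proj₁ e))
    ... | yes _ | no ne = ⊥-elim (ne (cong proj₂ e))
    -- The hidden decision procedure matches on `refl`, so it reduces only once p and p′ are `refl`;
    -- abstracting `to k` and `to l` into variables makes that match possible.
    ... | yes p | yes p′ with to k | to l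
    zero-direction i j k l e | yes refl | yes refl | _ | _ = refl
    nonzero-direction : ∀ i j k l → ¬ (to k , to l) ≡ O →
      proj₁ accept-sum i j k l ≡ ind (evalU (P (to i , to j) (to k , to l)) 0# ≟ f (to i , to j))
    nonzero-direction i j k l ne with to k ≟ 0# | to l ≟ 0#
    ... | no _  | _     = refl
    ... | yes p | yes p′ = ⊥-elim (ne (cong₂ _,_ p p′))
    ... | yes p | no _ with to k
    nonzero-direction i j k l ne | yes refl | no _ | _ = refl
    summand : ∀ i j k l → proj₁ accept-sum i j k l ≡ acc (to i , to j) (to k , to l)
    summand i j k l with (to k , to l) ≟₂ O
    ... | yes e = zero-direction i j k l e
    ... | no ne = trans (nonzero-direction i j k l ne) (sym (ℕₚ.*-identityˡ _))

  rej+acc : ∀ a b → rej a b + acc a b ≡ nz b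
  rej+acc a b = trans (sym (ℕₚ.*-distribˡ-+ (nz b) (ind (¬? p?)) (ind p?)))
    (trans (cong (nz b *_) (trans (ℕₚ.+-comm (ind (¬? p?)) (ind p?)) (ind-¬ p?))) (ℕₚ.*-identityʳ (nz b)))
    where p? = evalU (P a b) 0# ≟ f a

  V≡ : V ≡ q * q ∸ 1
  V≡ = cong (_∸ 1) 1+V

  Rej+accept : Rej + ldtAccept f B ≡ ldtTotal f
  Rej+accept = begin
    Rej + ldtAccept f B                                               ≡⟨ cong (Rej +_) accept≡ ⟩
    Rej + sumPt (λ a → sumPt (λ b → acc a b))                         ≡⟨ sym (ΣP.plus (λ a → sumPt (rej a)) (λ a → sumPt (acc a))) ⟩
    sumPt (λ a → sumPt (rej a) + sumPt (acc a))                       ≡⟨ ΣP.congr (λ a → sym (ΣP.plus (rej a) (acc a))) ⟩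
    sumPt (λ a → sumPt (λ b → rej a b + acc a b))                     ≡⟨ ΣP.congr (λ a → ΣP.congr (rej+acc a)) ⟩
    sumPt (λ a → V)                                                   ≡⟨ sumPt-const V ⟩
    q * q * V                                                         ≡⟨ cong (q * q *_) V≡ ⟩
    ldtTotal f                                                        ∎
    where open ≡-Reasoning

  -- Choice of the parallel class

  q′ : ℕ
  q′ = sumF (λ y → ind (¬? (y ≟ 0#)))

  1+q′ : suc q′ ≡ q
  1+q′ = begin
    1 + q′                                             ≡⟨ cong (_+ q′) (sym (sumF-single 0#)) ⟩
    sumF (λ y → ind (y ≟ 0#)) + q′                     ≡⟨ sym (ΣF.plus (λ y → ind (y ≟ 0#)) (λ y → ind (¬? (y ≟ 0#)))) ⟩
    sumF (λ y → ind (y ≟ 0#) + ind (¬? (y ≟ 0#)))      ≡⟨ ΣF.congr (λ y → ind-¬ (y ≟ 0#)) ⟩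
    sumF (λ _ → 1)                                     ≡⟨ sumF-1 ⟩
    q                                                  ∎
    where open ≡-Reasoning

  1≤q′ : 1 ≤ q′
  1≤q′ = ℕₚ.≤-pred (subst (2 ≤_) (sym 1+q′) 2≤q)

  -- Averaging is confined to the q q′ directions with nonzero second coordinate: a line in such a
  -- direction meets the axis y = 0 exactly once, and that point indexes the lines of the class.
  good-direction : ∃ λ (β : Pt) → ¬ proj₂ β ≡ 0# × q * q′ * sumPt (λ a → rej a β) ≤ Rej
  good-direction with average (λ b → ind (¬? (proj₂ b ≟ 0#))) (λ b → sumPt (λ a → rej a b)) Rej
      (ℕₚ.≤-trans (ΣP.mono (λ b → ℕₚ.≤-trans (ℕₚ.*-monoˡ-≤ (sumPt (λ a → rej a b)) (ind-≤1 (¬? (proj₂ b ≟ 0#)))) (ℕₚ.≤-reflexive (ℕₚ.*-identityˡ _)))) (ℕₚ.≤-reflexive sum-rej-swap))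
      (subst (0 <_) (sym (sumF-const q′)) (ℕₚ.*-mono-≤ (ℕₚ.≤-trans (s≤s z≤n) 2≤q) 1≤q′))
  ... | β , pos , le = β , nonzero pos , subst (λ W → W * sumPt (λ a → rej a β) ≤ Rej) (sumF-const q′) le
    where
    nonzero : 0 < ind (¬? (proj₂ β ≟ 0#)) → ¬ proj₂ β ≡ 0#
    nonzero pos e with proj₂ β ≟ 0#
    nonzero () e | yes _
    ... | no ne = ne e

  -- The interpolant as a function on the plane

  module Columns (β : Pt) (β₂≢0 : ¬ proj₂ β ≡ 0#) (e s : ℕ)
    (Ê : Fin (suc e) → Fin (suc s) → Carrier) (N̂ : Fin (suc e) → Fin (suc (d + s)) → Carrier)
    (equation : ∀ x t → evalU (P (x , 0#) β) t ⊗ ev₂ Ê x t ≡ ev₂ N̂ x t)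
    (nonvanishing : ∃ λ (p : Pt) → ¬ ev₂ Ê (proj₁ p) (proj₂ p) ≡ 0#) where

    private
      β₁ β₂ κ : Carrier
      β₁ = proj₁ β
      β₂ = proj₂ β
      κ = proj₁ (inverse β₂ β₂≢0)

      β₂κ : β₂ ⊗ κ ≡ 1#
      β₂κ = proj₂ (inverse β₂ β₂≢0)

      β≢0 : ¬ β ≡ O
      β≢0 e = β₂≢0 (cong proj₂ e)

    -- p = linePt (xc p , 0) β (tc p)
    tc xc : Pt → Carrier
    tc p = κ ⊗ proj₂ p
    xc p = proj₁ p ⊕ (⊖ β₁) ⊗ (κ ⊗ proj₂ p)

    private
      cancel : ∀ x t → ((x ⊕ t ⊗ β₁) ⊕ (⊖ β₁) ⊗ t) ≡ x
      cancel x t = trans (solve 4 (λ x t b b′ → (x :+ t :* b) :+ b′ :* t := x :+ t :* (b :+ b′)) refl x t β₁ (⊖ β₁))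
        (trans (cong (λ z → x ⊕ t ⊗ z) (a⊕[⊖a] β₁)) (trans (cong (x ⊕_) (R.zeroʳ t)) (R.+-identityʳ x)))

      cancel′ : ∀ x t → ((x ⊕ (⊖ β₁) ⊗ t) ⊕ t ⊗ β₁) ≡ x
      cancel′ x t = trans (solve 4 (λ x t b b′ → (x :+ b′ :* t) :+ t :* b := (x :+ t :* b) :+ b′ :* t) refl x t β₁ (⊖ β₁)) (cancel x t)

      κβ₂ : ∀ t → κ ⊗ (t ⊗ β₂) ≡ t
      κβ₂ t = trans (solve 3 (λ k t b → k :* (t :* b) := t :* (b :* k)) refl κ t β₂) (trans (cong (t ⊗_) β₂κ) (R.*-identityʳ t))

      κβ₂′ : ∀ t → κ ⊗ t ⊗ β₂ ≡ t
      κβ₂′ t = trans (solve 3 (λ k t b → k :* t :* b := k :* (t :* b)) refl κ t β₂) (κβ₂ t)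

    line-coords : ∀ p → linePt (xc p , 0#) β (tc p) ≡ p
    line-coords (x , y) = cong₂ _,_ (cancel′ x (κ ⊗ y)) (trans (R.+-identityˡ _) (κβ₂′ y))

    E N : Pt → Carrier
    E p = ev₂ Ê (xc p) (tc p)
    N p = ev₂ N̂ (xc p) (tc p)

    private
      tc-Deg : Deg 1 tc
      tc-Deg = ext (λ p → cong (κ ⊗_) (R.*-identityʳ _)) (Deg-scale κ (mulY (con 1#)))

      xc-Deg : Deg 1 xc
      xc-Deg = add (ext (λ p → R.*-identityʳ _) (mulX (con 1#))) (Deg-scale (⊖ β₁) tc-Deg)

    E-Deg : Deg (e + s) E
    E-Deg = Deg-cast (cong (e +_) (ℕₚ.+-identityʳ s)) (Deg-ev (λ i → Deg-ev (λ j → con (Ê i j)) tc-Deg) xc-Deg)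

    N-Deg : Deg (d + (e + s)) N
    N-Deg = Deg-cast (lem e d s) (Deg-ev (λ i → Deg-ev (λ j → con (N̂ i j)) tc-Deg) xc-Deg)
      where
      lem : ∀ e d s → e + ((d + s) + 0) ≡ d + (e + s)
      lem = solve-∀

    -- `equation` concerns the polynomial of the line based at (xc p, 0). Moving the base to p turns
    -- its value there into the one that the test compares with f.
    agree : ∀ p → evalU (P p β) 0# ≡ f p → f p ⊗ E p ≡ N p
    agree p eq = trans (cong (_⊗ E p) (trans (sym eq) (sym (trans (on-line (xc p , 0#) β (tc p) β≢0)
      (cong (λ z → evalU (P z β) 0#) (line-coords p)))))) (equation (xc p) (tc p))

    NZ-bound : (q ∸ e) * (q ∸ s) ≤ sumPt (λ p → ind (¬? (E p ≟ 0#)))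
    NZ-bound = ℕₚ.≤-trans (many-nonroots₂ Ê nonvanishing) (ℕₚ.≤-reflexive (sym change))
      where
      open ≡-Reasoning
      g : Carrier → Carrier → ℕ
      g x t = ind (¬? (ev₂ Ê x t ≟ 0#))
      change : sumPt (λ p → ind (¬? (E p ≟ 0#))) ≡ sumPt (λ p → g (proj₁ p) (proj₂ p))
      change = begin
        sumF (λ x → sumF (λ y → g (x ⊕ (⊖ β₁) ⊗ (κ ⊗ y)) (κ ⊗ y)))
          ≡⟨ ΣF.congr (λ x → sumF-permute (κ ⊗_) (_⊗ β₂) κβ₂ κβ₂′ (λ t → g (x ⊕ (⊖ β₁) ⊗ t) t)) ⟩
        sumF (λ x → sumF (λ t → g (x ⊕ (⊖ β₁) ⊗ t) t))
          ≡⟨ ΣF.swap {q} (λ x i → g (x ⊕ (⊖ β₁) ⊗ to i) (to i)) ⟩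
        sumF (λ t → sumF (λ x → g (x ⊕ (⊖ β₁) ⊗ t) t))
          ≡⟨ ΣF.congr (λ t → sumF-permute (λ x → x ⊕ (⊖ β₁) ⊗ t) (λ x → x ⊕ t ⊗ β₁) (λ x → cancel x t) (λ x → cancel′ x t) (λ x → g x t)) ⟩
        sumF (λ t → sumF (λ x → g x t))
          ≡⟨ ΣF.swap {q} (λ t i → g (to i) t) ⟩
        sumF (λ x → sumF (λ t → g x t)) ∎

  -- Bad lines, choice of the centre, and approximation by a polynomial

  module Centre (β : Pt) (β≢0 : ¬ β ≡ O) (K : ℕ) (E N : Pt → Carrier) (E-Deg : Deg K E) (N-Deg : Deg (d + K) N)
    (agree : ∀ p → evalU (P p β) 0# ≡ f p → f p ⊗ E p ≡ N p) where

    NZ : ℕ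
    NZ = sumPt (λ p → ind (¬? (E p ≟ 0#)))

    unlike : Pt → ℕ
    unlike p = ind (¬? (f p ⊗ E p ≟ N p))

    unlike≤rej : ∀ p → unlike p ≤ rej p β
    unlike≤rej p = ℕₚ.≤-trans (ind-mono (¬? (f p ⊗ E p ≟ N p)) (¬? (evalU (P p β) 0# ≟ f p)) (λ ne eq → ne (agree p eq)))
      (ℕₚ.≤-reflexive (sym (trans (cong (_* ind (¬? (evalU (P p β) 0# ≟ f p))) (ind-yes (¬? (β ≟₂ O)) β≢0)) (ℕₚ.*-identityˡ _))))

    h : ℕ
    h = d + K

    match : Pt → Pt → ℕ
    match a b = sumF (λ t → ind (evalU (P a b) t ⊗ E (linePt a b t) ≟ N (linePt a b t)))

    -- Marks the lines on which P·E = N need not hold identically: both sides have degree at most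
    -- `h` in t, and `suc h` matches are what `reconstruct` asks for.
    bad : Pt → Pt → ℕ
    bad a b = nz b * ind (¬? (suc h ≤? match a b))

    -- At each of the q parameters P·E = N holds, or P misses f, or f·E differs from N. A bad line
    -- has at most h parameters of the first kind, so at least q - h of the others. The factor `bad`
    -- makes the bound trivial elsewhere, and h stands on the right to avoid subtraction.
    bad-bound : ∀ a b → q * bad a b ≤ h * bad a b + (sumF (err a b) + sumF (λ t → nz b * unlike (linePt a b t)))
    bad-bound a b = by-cases (b ≟₂ O) (suc h ≤? match a b)
      where
      open ℕₚ.≤-Reasoning
      R′ = sumF (λ t → 1 * miss a b t) + sumF (λ t → 1 * unlike (linePt a b t))
      m : Carrier → ℕ
      m t = ind (evalU (P a b) t ⊗ E (linePt a b t) ≟ N (linePt a b t))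
      cover : ∀ t → 1 ≤ m t + (1 * miss a b t + 1 * unlike (linePt a b t))
      cover t = dec (evalU (P a b) t ≟ f (linePt a b t)) (f (linePt a b t) ⊗ E (linePt a b t) ≟ N (linePt a b t))
        where
        dec : (m? : Dec (evalU (P a b) t ≡ f (linePt a b t))) (u? : Dec (f (linePt a b t) ⊗ E (linePt a b t) ≡ N (linePt a b t))) →
              1 ≤ m t + (1 * ind (¬? m?) + 1 * ind (¬? u?))
        dec (no _)  _        = ℕₚ.≤-trans (s≤s z≤n) (ℕₚ.m≤n+m _ (m t))
        dec (yes _) (no _)   = ℕₚ.m≤n+m 1 (m t)
        dec (yes p) (yes p′) = ℕₚ.≤-trans (ℕₚ.≤-reflexive (sym (ind-yes (evalU (P a b) t ⊗ E (linePt a b t) ≟ N (linePt a b t))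
                               (trans (cong (_⊗ E (linePt a b t)) p) p′)))) (ℕₚ.m≤m+n (m t) _)
      by-cases : (z? : Dec (b ≡ O)) (g? : Dec (suc h ≤ match a b)) →
        q * (ind (¬? z?) * ind (¬? g?)) ≤ h * (ind (¬? z?) * ind (¬? g?)) +
          (sumF (λ t → ind (¬? z?) * miss a b t) + sumF (λ t → ind (¬? z?) * unlike (linePt a b t)))
      by-cases (yes _) _        = ℕₚ.≤-trans (ℕₚ.≤-reflexive (ℕₚ.*-zeroʳ q)) z≤n
      by-cases (no _)  (yes _)  = ℕₚ.≤-trans (ℕₚ.≤-reflexive (ℕₚ.*-zeroʳ q)) z≤n
      by-cases (no _)  (no nle) = begin
        q * 1                        ≡⟨ ℕₚ.*-identityʳ q ⟩
        q                            ≡⟨ sym sumF-1 ⟩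
        sumF (λ _ → 1)               ≤⟨ ΣF.mono cover ⟩
        sumF (λ t → m t + (1 * miss a b t + 1 * unlike (linePt a b t)))
          ≡⟨ trans (ΣF.plus m (λ t → 1 * miss a b t + 1 * unlike (linePt a b t)))
               (cong (match a b +_) (ΣF.plus (λ t → 1 * miss a b t) (λ t → 1 * unlike (linePt a b t)))) ⟩
        match a b + R′               ≤⟨ ℕₚ.+-monoˡ-≤ R′ (ℕₚ.≤-trans (ℕₚ.≤-pred (ℕₚ.≰⇒> nle)) (ℕₚ.≤-reflexive (sym (ℕₚ.*-identityʳ h)))) ⟩
        h * 1 + R′                   ∎

    Z Unlike : ℕ
    Z = sumPt (λ a → sumPt (bad a))
    Unlike = sumPt unlike

    sum-unlike : sumPt (λ a → sumPt (λ b → sumF (λ t → nz b * unlike (linePt a b t)))) ≡ q * (V * Unlike)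
    sum-unlike = trans (sumPt²-sumF (λ a b t → nz b * unlike (linePt a b t))) (trans (ΣF.congr each) (sumF-const (V * Unlike)))
      where
      each : ∀ t → sumPt (λ a → sumPt (λ b → nz b * unlike (linePt a b t))) ≡ V * Unlike
      each t = trans (sumPt-sumPt (λ a b → nz b * unlike (linePt a b t)))
        (trans (ΣP.congr (λ b → trans (ΣP.scale (nz b) (λ a → unlike (linePt a b t))) (cong (nz b *_) (sumPt-translate (t • b) unlike))))
          (ΣP.scaleʳ Unlike nz))

    Z-bound : q * Z ≤ h * Z + (q * Rej + q * (V * sumPt (λ a → rej a β)))
    Z-bound = begin
      q * Z                                    ≡⟨ sym (scale₂ q) ⟩
      sumPt (λ a → sumPt (λ b → q * bad a b))  ≤⟨ ΣP.mono (λ a → ΣP.mono (bad-bound a)) ⟩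
      sumPt (λ a → sumPt (λ b → h * bad a b + (x a b + y a b)))
        ≡⟨ plus₂ (λ a b → h * bad a b) (λ a b → x a b + y a b) ⟩
      sumPt (λ a → sumPt (λ b → h * bad a b)) + sumPt (λ a → sumPt (λ b → x a b + y a b))
        ≡⟨ cong₂ _+_ (scale₂ h) (trans (plus₂ x y) (cong₂ _+_ sum-sum-err sum-unlike)) ⟩
      h * Z + (q * Rej + q * (V * Unlike))
        ≤⟨ ℕₚ.+-monoʳ-≤ (h * Z) (ℕₚ.+-monoʳ-≤ (q * Rej) (ℕₚ.*-monoʳ-≤ q (ℕₚ.*-monoʳ-≤ V (ΣP.mono unlike≤rej)))) ⟩
      h * Z + (q * Rej + q * (V * sumPt (λ a → rej a β))) ∎
      where
      open ℕₚ.≤-Reasoning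
      x y : Pt → Pt → ℕ
      x a b = sumF (err a b)
      y a b = sumF (λ t → nz b * unlike (linePt a b t))
      plus₂ : ∀ (g g′ : Pt → Pt → ℕ) → sumPt (λ a → sumPt (λ b → g a b + g′ a b)) ≡ sumPt (λ a → sumPt (g a)) + sumPt (λ a → sumPt (g′ a))
      plus₂ g g′ = trans (ΣP.congr (λ a → ΣP.plus (g a) (g′ a))) (ΣP.plus (λ a → sumPt (g a)) (λ a → sumPt (g′ a)))
      scale₂ : ∀ c → sumPt (λ a → sumPt (λ b → c * bad a b)) ≡ c * Z
      scale₂ c = trans (ΣP.congr (λ a → ΣP.scale c (bad a))) (ΣP.scale c (λ a → sumPt (bad a)))

    -- Bounds the number of directions b in which the value at a + b is not under control: P misses
    -- f there, or the line is bad. Parameter 1 is used because a + b then runs over the plane with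
    -- b.
    T : Pt → ℕ
    T a = sumPt (λ b → err a b 1# + bad a b)

    sum-T : sumPt T ≡ Rej + Z
    sum-T = trans (ΣP.congr (λ a → ΣP.plus (λ b → err a b 1#) (bad a)))
      (trans (ΣP.plus (λ a → sumPt (λ b → err a b 1#)) (λ a → sumPt (bad a))) (cong (_+ Z) (sum-err 1#)))

    centre : 0 < NZ → ∃ λ a → ¬ E a ≡ 0# × NZ * T a ≤ Rej + Z
    centre pos with average (λ p → ind (¬? (E p ≟ 0#))) T (Rej + Z)
        (ℕₚ.≤-trans (ΣP.mono (λ b → ℕₚ.≤-trans (ℕₚ.*-monoˡ-≤ (T b) (ind-≤1 (¬? (E b ≟ 0#)))) (ℕₚ.≤-reflexive (ℕₚ.*-identityˡ _)))) (ℕₚ.≤-reflexive sum-T)) pos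
    ... | a , pos′ , le = a , nonzero pos′ , le
      where
      nonzero : 0 < ind (¬? (E a ≟ 0#)) → ¬ E a ≡ 0#
      nonzero pos e with E a ≟ 0#
      nonzero () e | yes _
      ... | no ne = ne e

    -- On a good line Q(a + b) = P(1), which is f(a + b) unless P misses there. The extra 1 pays for
    -- b = 0, the centre itself, where no line is counted.
    distance : ∀ a (Q : BiPoly) → (∀ b (P : UPoly) →
        suc h ≤ sumF (λ t → ind (evalU P t ⊗ E (linePt a b t) ≟ N (linePt a b t))) → evalB Q (b ⊞ a) ≡ evalU P 1#) →
      sumPt (λ p → ind (¬? (f p ≟ evalB Q p))) ≤ 1 + T a
    distance a Q Q-eq = begin
        sumPt m                                            ≡⟨ sym (sumPt-translate a m) ⟩
        sumPt (λ b → m (b ⊞ a))                            ≤⟨ ΣP.mono cover ⟩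
        sumPt (λ b → ind (b ≟₂ O) + (err a b 1# + bad a b)) ≡⟨ ΣP.plus (λ b → ind (b ≟₂ O)) (λ b → err a b 1# + bad a b) ⟩
        sumPt (λ b → ind (b ≟₂ O)) + T a                   ≡⟨ cong (_+ T a) (sumPt-single O) ⟩
        1 + T a                                            ∎
      where
      open ℕₚ.≤-Reasoning
      m : Pt → ℕ
      m p = ind (¬? (f p ≟ evalB Q p))
      line-1 : ∀ b → linePt a b 1# ≡ b ⊞ a
      line-1 b = cong₂ _,_ (lem _ _) (lem _ _)
        where
        lem : ∀ x y → x ⊕ 1# ⊗ y ≡ y ⊕ x
        lem x y = trans (cong (x ⊕_) (R.*-identityˡ y)) (R.+-comm x y)
      cover : ∀ b → m (b ⊞ a) ≤ ind (b ≟₂ O) + (err a b 1# + bad a b)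
      cover b = by-cases (b ≟₂ O) (suc h ≤? match a b)
        where
        by-cases : (z? : Dec (b ≡ O)) (g? : Dec (suc h ≤ match a b)) →
          m (b ⊞ a) ≤ ind z? + (ind (¬? z?) * miss a b 1# + ind (¬? z?) * ind (¬? g?))
        by-cases (yes _) _        = ℕₚ.≤-trans (ind-≤1 (¬? (f (b ⊞ a) ≟ evalB Q (b ⊞ a)))) (s≤s z≤n)
        by-cases (no _)  (no _)   = ℕₚ.≤-trans (ind-≤1 (¬? (f (b ⊞ a) ≟ evalB Q (b ⊞ a)))) (ℕₚ.m≤n+m 1 (1 * miss a b 1#))
        by-cases (no _)  (yes le) = ℕₚ.≤-trans (ind-mono (¬? (f (b ⊞ a) ≟ evalB Q (b ⊞ a))) (¬? (evalU (P a b) 1# ≟ f (linePt a b 1#)))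
            (λ ne eq → ne (sym (trans (Q-eq b (P a b) le) (trans eq (cong f (line-1 b)))))))
          (ℕₚ.≤-reflexive (sym (trans (ℕₚ.+-identityʳ _) (ℕₚ.*-identityˡ (miss a b 1#)))))

    approximation : ∀ a → ¬ E a ≡ 0# → ∃ λ (Q : BiPoly) → sumPt (λ p → ind (¬? (f p ≟ evalB Q p))) ≤ 1 + T a
    approximation a Ea≢0 = proj₁ Q , distance a (proj₁ Q) (proj₂ Q)
      where
      Q : ∃ λ (Q : BiPoly) → ∀ b (P : UPoly) →
        suc h ≤ sumF (λ t → ind (evalU P t ⊗ E (linePt a b t) ≟ N (linePt a b t))) → evalB Q (b ⊞ a) ≡ evalU P 1#
      Q = reconstruct E-Deg N-Deg a Ea≢0

  -- First and second moments of a set of points on a random line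

  sumPt-pick : ∀ (g : Pt → ℕ) v → sumPt (λ b → ind (b ≟₂ v) * g b) ≡ g v
  sumPt-pick g v = trans (ΣP.congr pointwise) (trans (ΣP.scaleʳ (g v) (λ b → ind (b ≟₂ v)))
      (trans (cong (_* g v) (sumPt-single v)) (ℕₚ.*-identityˡ (g v))))
    where
    pointwise : ∀ b → ind (b ≟₂ v) * g b ≡ ind (b ≟₂ v) * g v
    pointwise b with b ≟₂ v
    ... | yes refl = refl
    ... | no _     = refl

  nz-scale : ∀ c → ¬ c ≡ 0# → ∀ b → nz b ≡ nz (c • b)
  nz-scale c c≢0 b = ℕₚ.≤-antisym
      (ind-mono (¬? (b ≟₂ O)) (¬? (c • b ≟₂ O)) (λ ne e → ne (cong₂ _,_ (cancel _ (cong proj₁ e)) (cancel _ (cong proj₂ e)))))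
      (ind-mono (¬? (c • b ≟₂ O)) (¬? (b ≟₂ O)) (λ ne e → ne (trans (cong (c •_) e) (cong₂ _,_ (R.zeroʳ c) (R.zeroʳ c)))))
    where
    cancel : ∀ x → c ⊗ x ≡ 0# → x ≡ 0#
    cancel x e = ⊗-cancelʳ x 0# c c≢0 (trans (R.*-comm x c) (trans e (sym (R.zeroˡ c))))

  module _ (m : Pt → ℕ) (m² : ∀ p → m p * m p ≡ m p) where

    private
      M : ℕ
      M = sumPt m

    pairs : Carrier → Carrier → ℕ
    pairs t t′ = sumPt (λ a → sumPt (λ b → nz b * (m (linePt a b t) * m (linePt a b t′))))

    pairs-diagonal : ∀ t → pairs t t ≡ V * M
    pairs-diagonal t = begin
      pairs t t                                               ≡⟨ sumPt-sumPt (λ a b → nz b * (m (linePt a b t) * m (linePt a b t))) ⟩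
      sumPt (λ b → sumPt (λ a → nz b * (m (linePt a b t) * m (linePt a b t))))
        ≡⟨ ΣP.congr (λ b → trans (ΣP.scale (nz b) (λ a → m (linePt a b t) * m (linePt a b t)))
             (cong (nz b *_) (trans (ΣP.congr (λ a → m² (linePt a b t))) (sumPt-translate (t • b) m)))) ⟩
      sumPt (λ b → nz b * M)                                  ≡⟨ ΣP.scaleʳ M nz ⟩
      V * M                                                   ∎
      where open ≡-Reasoning

    neighbours : ∀ a → m a + sumPt (λ b → nz b * m (b ⊞ a)) ≡ M
    neighbours a = begin
      m a + sumPt (λ b → nz b * m (b ⊞ a))
        ≡⟨ cong (_+ sumPt (λ b → nz b * m (b ⊞ a))) (trans (cong m (cong₂ _,_ (sym (R.+-identityˡ _)) (sym (R.+-identityˡ _)))) (sym (sumPt-pick (λ b → m (b ⊞ a)) O))) ⟩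
      sumPt (λ b → ind (b ≟₂ O) * m (b ⊞ a)) + sumPt (λ b → nz b * m (b ⊞ a))
        ≡⟨ sym (ΣP.plus (λ b → ind (b ≟₂ O) * m (b ⊞ a)) (λ b → nz b * m (b ⊞ a))) ⟩
      sumPt (λ b → ind (b ≟₂ O) * m (b ⊞ a) + nz b * m (b ⊞ a))
        ≡⟨ ΣP.congr (λ b → trans (sym (ℕₚ.*-distribʳ-+ (m (b ⊞ a)) (ind (b ≟₂ O)) (nz b)))
             (trans (cong (_* m (b ⊞ a)) (ind-¬ (b ≟₂ O))) (ℕₚ.*-identityˡ (m (b ⊞ a))))) ⟩
      sumPt (λ b → m (b ⊞ a))
        ≡⟨ sumPt-translate a m ⟩
      M ∎
      where open ≡-Reasoning

    -- As (a, b) varies with b nonzero, (a + t b, a + t′ b) runs once through the ordered pairs of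
    -- distinct points: translate a by t b, then scale b by t′ - t. The summand `M` on the left
    -- supplies the coinciding pairs, since `m` is idempotent.
    pairs-off-diagonal : ∀ t t′ → ¬ t ≡ t′ → M + pairs t t′ ≡ M * M
    pairs-off-diagonal t t′ t≢t′ = begin
      M + pairs t t′
        ≡⟨ cong (M +_) (sumPt-sumPt (λ a b → nz b * (m (linePt a b t) * m (linePt a b t′)))) ⟩
      M + sumPt (λ b → sumPt (λ a → nz b * (m (linePt a b t) * m (linePt a b t′))))
        ≡⟨ cong (M +_) (ΣP.congr (λ b → trans (ΣP.congr (λ a → cong (λ p → nz b * (m (linePt a b t) * m p)) (shift a b)))
             (sumPt-translate (t • b) (λ a → nz b * (m a * m ((c • b) ⊞ a)))))) ⟩
      M + sumPt (λ b → sumPt (λ a → nz b * (m a * m ((c • b) ⊞ a))))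
        ≡⟨ cong (M +_) (sumPt-sumPt (λ b a → nz b * (m a * m ((c • b) ⊞ a)))) ⟩
      M + sumPt (λ a → sumPt (λ b → nz b * (m a * m ((c • b) ⊞ a))))
        ≡⟨ cong (M +_) (ΣP.congr (λ a → trans (ΣP.congr (λ b → cong (_* (m a * m ((c • b) ⊞ a))) (nz-scale c c≢0 b)))
             (sumPt-scale c c≢0 (λ b → nz b * (m a * m (b ⊞ a)))))) ⟩
      M + sumPt (λ a → sumPt (λ b → nz b * (m a * m (b ⊞ a))))
        ≡⟨ cong (M +_) (ΣP.congr (λ a → trans (ΣP.congr (λ b → swap (nz b) (m a) (m (b ⊞ a)))) (ΣP.scale (m a) (λ b → nz b * m (b ⊞ a))))) ⟩
      M + sumPt (λ a → m a * sumPt (λ b → nz b * m (b ⊞ a)))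
        ≡⟨ cong (_+ sumPt (λ a → m a * sumPt (λ b → nz b * m (b ⊞ a)))) (ΣP.congr (λ a → sym (m² a))) ⟩
      sumPt (λ a → m a * m a) + sumPt (λ a → m a * sumPt (λ b → nz b * m (b ⊞ a)))
        ≡⟨ sym (ΣP.plus (λ a → m a * m a) (λ a → m a * sumPt (λ b → nz b * m (b ⊞ a)))) ⟩
      sumPt (λ a → m a * m a + m a * sumPt (λ b → nz b * m (b ⊞ a)))
        ≡⟨ ΣP.congr (λ a → trans (sym (ℕₚ.*-distribˡ-+ (m a) (m a) _)) (cong (m a *_) (neighbours a))) ⟩
      sumPt (λ a → m a * M)
        ≡⟨ ΣP.scaleʳ M m ⟩
      M * M ∎
      where
      open ≡-Reasoning
      c : Carrier
      c = t′ ⊕ ⊖ t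
      c≢0 : ¬ c ≡ 0#
      c≢0 e = t≢t′ (sym (x⊕⊖y≡0⇒x≡y t′ t e))
      swap : ∀ x y z → x * (y * z) ≡ y * (x * z)
      swap = solve-∀
      shift : ∀ a b → linePt a b t′ ≡ (c • b) ⊞ linePt a b t
      shift a b = cong₂ _,_ (lem _ _) (lem _ _)
        where
        lem : ∀ x y → x ⊕ t′ ⊗ y ≡ c ⊗ y ⊕ (x ⊕ t ⊗ y)
        lem x y = trans (cong (λ z → x ⊕ z ⊗ y) (sym (a⊕⊖b⊕b t′ t)))
          (solve 4 (λ x y c t → x :+ (c :+ t) :* y := c :* y :+ (x :+ t :* y)) refl x y c t)

    second-moment : sumPt (λ a → sumPt (λ b → nz b * (sumF (λ t → m (linePt a b t)) * sumF (λ t → m (linePt a b t)))))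
                    ≡ q * (V * M + q′ * (M * M ∸ M))
    second-moment = begin
      sumPt (λ a → sumPt (λ b → nz b * (sumF (λ t → m (linePt a b t)) * sumF (λ t → m (linePt a b t)))))
        ≡⟨ ΣP.congr (λ a → ΣP.congr (λ b → square a b)) ⟩
      sumPt (λ a → sumPt (λ b → sumF (λ t → sumF (λ t′ → nz b * (m (linePt a b t) * m (linePt a b t′))))))
        ≡⟨ sumPt²-sumF (λ a b t → sumF (λ t′ → nz b * (m (linePt a b t) * m (linePt a b t′)))) ⟩
      sumF (λ t → sumPt (λ a → sumPt (λ b → sumF (λ t′ → nz b * (m (linePt a b t) * m (linePt a b t′))))))
        ≡⟨ ΣF.congr (λ t → sumPt²-sumF (λ a b t′ → nz b * (m (linePt a b t) * m (linePt a b t′)))) ⟩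
      sumF (λ t → sumF (λ t′ → pairs t t′))
        ≡⟨ ΣF.congr row ⟩
      sumF (λ t → V * M + q′ * (M * M ∸ M))
        ≡⟨ sumF-const (V * M + q′ * (M * M ∸ M)) ⟩
      q * (V * M + q′ * (M * M ∸ M)) ∎
      where
      open ≡-Reasoning
      square : ∀ a b → nz b * (sumF (λ t → m (linePt a b t)) * sumF (λ t → m (linePt a b t))) ≡
               sumF (λ t → sumF (λ t′ → nz b * (m (linePt a b t) * m (linePt a b t′))))
      square a b = sym (trans
        (ΣF.congr (λ t → trans (ΣF.scale (nz b) (λ t′ → m (linePt a b t) * m (linePt a b t′)))
          (cong (nz b *_) (ΣF.scale (m (linePt a b t)) (λ t′ → m (linePt a b t′))))))
        (trans (ΣF.scale (nz b) (λ t → m (linePt a b t) * sumF (λ t′ → m (linePt a b t′))))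
          (cong (nz b *_) (ΣF.scaleʳ (sumF (λ t′ → m (linePt a b t′))) (λ t → m (linePt a b t))))))
      entry : ∀ t t′ (e? : Dec (t′ ≡ t)) → pairs t t′ ≡ ind e? * (V * M) + ind (¬? e?) * (M * M ∸ M)
      entry t t′ (yes e) = trans (cong (pairs t) e) (trans (pairs-diagonal t) (sym (trans (ℕₚ.+-identityʳ _) (ℕₚ.*-identityˡ (V * M)))))
      entry t t′ (no ne) = sym (trans (ℕₚ.*-identityˡ (M * M ∸ M))
        (trans (cong (_∸ M) (sym (pairs-off-diagonal t t′ (λ e → ne (sym e))))) (ℕₚ.m+n∸m≡n M (pairs t t′))))
      off : ∀ t → sumF (λ t′ → ind (¬? (t′ ≟ t))) ≡ q′
      off t = ℕₚ.suc-injective (trans (trans (cong (_+ sumF (λ t′ → ind (¬? (t′ ≟ t)))) (sym (sumF-single t)))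
        (trans (sym (ΣF.plus (λ t′ → ind (t′ ≟ t)) (λ t′ → ind (¬? (t′ ≟ t))))) (trans (ΣF.congr (λ t′ → ind-¬ (t′ ≟ t))) sumF-1))) (sym 1+q′))
      row : ∀ t → sumF (λ t′ → pairs t t′) ≡ V * M + q′ * (M * M ∸ M)
      row t = trans (ΣF.congr (λ t′ → entry t t′ (t′ ≟ t)))
        (trans (ΣF.plus (λ t′ → ind (t′ ≟ t) * (V * M)) (λ t′ → ind (¬? (t′ ≟ t)) * (M * M ∸ M)))
          (cong₂ _+_
            (trans (ΣF.scaleʳ (V * M) (λ t′ → ind (t′ ≟ t))) (trans (cong (_* (V * M)) (sumF-single t)) (ℕₚ.*-identityˡ (V * M))))
            (trans (ΣF.scaleʳ (M * M ∸ M) (λ t′ → ind (¬? (t′ ≟ t)))) (cong (_* (M * M ∸ M)) (off t)))))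

    first-moment : sumPt (λ a → sumPt (λ b → nz b * sumF (λ t → m (linePt a b t)))) ≡ q * (V * M)
    first-moment = begin
      sumPt (λ a → sumPt (λ b → nz b * sumF (λ t → m (linePt a b t))))
        ≡⟨ ΣP.congr (λ a → ΣP.congr (λ b → sym (ΣF.scale (nz b) (λ t → m (linePt a b t))))) ⟩
      sumPt (λ a → sumPt (λ b → sumF (λ t → nz b * m (linePt a b t))))
        ≡⟨ sumPt²-sumF (λ a b t → nz b * m (linePt a b t)) ⟩
      sumF (λ t → sumPt (λ a → sumPt (λ b → nz b * m (linePt a b t))))
        ≡⟨ ΣF.congr (λ t → trans (sumPt-sumPt (λ a b → nz b * m (linePt a b t)))
             (trans (ΣP.congr (λ b → trans (ΣP.scale (nz b) (λ a → m (linePt a b t))) (cong (nz b *_) (sumPt-translate (t • b) m))))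
               (ΣP.scaleʳ M nz))) ⟩
      sumF (λ t → V * M)
        ≡⟨ sumF-const (V * M) ⟩
      q * (V * M) ∎
      where open ≡-Reasoning

  -- Line polynomials compared with one bivariate polynomial

  Deg-powX : ∀ i → Deg i (λ p → pow (proj₁ p) i)
  Deg-powX zero    = con 1#
  Deg-powX (suc i) = mulX (Deg-powX i)

  Deg-powY : ∀ i → Deg i (λ p → pow (proj₂ p) i)
  Deg-powY zero    = con 1#
  Deg-powY (suc i) = mulY (Deg-powY i)

  -- The square array by itself allows degree 2d; `totalDeg` kills every monomial above degree d.
  Deg-evalB : ∀ Q → Deg d (evalB Q)
  Deg-evalB Q = Deg-sumC (λ i → Deg-sumC (λ j → monomial i j))
    where
    open BiPoly Q
    monomial : ∀ i j → Deg d (λ p → coeff i j ⊗ (pow (proj₁ p) (toℕ i) ⊗ pow (proj₂ p) (toℕ j)))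
    monomial i j with toℕ i + toℕ j ≤? d
    ... | yes le = Deg-scale (coeff i j) (Deg-≤ le (Deg-mul (Deg-powX (toℕ i)) (Deg-powY (toℕ j))))
    ... | no nle = ext (λ p → sym (trans (cong (_⊗ (pow (proj₁ p) (toℕ i) ⊗ pow (proj₂ p) (toℕ j))) (totalDeg i j (ℕₚ.≰⇒> nle))) (R.zeroˡ _))) (con 0#)

  module _ (Q : BiPoly) where

    dis : Pt → ℕ
    dis p = ind (¬? (f p ≟ evalB Q p))

    -- On the line P and Q both have degree at most d. If they agree more than d times they
    -- coincide, and the misses of P are the disagreements of Q with f. Otherwise all but at most d
    -- parameters show a miss or a disagreement.
    line-dichotomy : ∀ a b → sumF (miss a b) ≡ sumF (λ t → dis (linePt a b t)) ⊎
                     q ≤ d + (sumF (miss a b) + sumF (λ t → dis (linePt a b t)))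
    line-dichotomy a b = by-cases (suc d ≤? sumF (λ t → ind (p t ≟ r t)))
      where
      open Expansion (expand a (Deg-evalB Q))
      p r : Carrier → Carrier
      p t = ev (P a b) t
      r t = evℕ (suc d) (λ k → co k b) t
      P≡p : ∀ t → evalU (P a b) t ≡ p t
      P≡p = sumC≡ev (P a b)
      same : (∀ i → P a b i ≡ co (toℕ i) b) → ∀ t → miss a b t ≡ dis (linePt a b t)
      same eq t = ℕₚ.≤-antisym
          (ind-mono (¬? (evalU (P a b) t ≟ f (linePt a b t))) (¬? (f (linePt a b t) ≟ evalB Q (linePt a b t))) (λ ne e → ne (trans P≡Q (sym e))))
          (ind-mono (¬? (f (linePt a b t) ≟ evalB Q (linePt a b t))) (¬? (evalU (P a b) t ≟ f (linePt a b t))) (λ ne e → ne (trans (sym e) P≡Q)))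
        where
        P≡Q : evalU (P a b) t ≡ evalB Q (linePt a b t)
        P≡Q = trans (P≡p t) (trans (ev-cong {suc d} eq t) (sym (co-eq b t)))
      cover : ∀ t → 1 ≤ ind (p t ≟ r t) + (miss a b t + dis (linePt a b t))
      cover t = dec (evalU (P a b) t ≟ f (linePt a b t)) (f (linePt a b t) ≟ evalB Q (linePt a b t))
        where
        dec : (m? : Dec (evalU (P a b) t ≡ f (linePt a b t))) (u? : Dec (f (linePt a b t) ≡ evalB Q (linePt a b t))) →
              1 ≤ ind (p t ≟ r t) + (ind (¬? m?) + ind (¬? u?))
        dec (no _)  _        = ℕₚ.≤-trans (s≤s z≤n) (ℕₚ.m≤n+m _ (ind (p t ≟ r t)))
        dec (yes _) (no _)   = ℕₚ.m≤n+m 1 (ind (p t ≟ r t))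
        dec (yes e) (yes e′) = ℕₚ.≤-trans (ℕₚ.≤-reflexive (sym (ind-yes (p t ≟ r t)
          (trans (sym (P≡p t)) (trans e (trans e′ (co-eq b t))))))) (ℕₚ.m≤m+n (ind (p t ≟ r t)) _)
      by-cases : Dec (suc d ≤ sumF (λ t → ind (p t ≟ r t))) → _
      by-cases (yes le) = inj₁ (ΣF.congr (same (identity-theorem {suc d} (P a b) (λ i → co (toℕ i) b) le)))
      by-cases (no nle) = inj₂ (begin
        q                                                                   ≡⟨ sym sumF-1 ⟩
        sumF (λ _ → 1)                                                      ≤⟨ ΣF.mono cover ⟩
        sumF (λ t → ind (p t ≟ r t) + (miss a b t + dis (linePt a b t)))
          ≡⟨ trans (ΣF.plus (λ t → ind (p t ≟ r t)) (λ t → miss a b t + dis (linePt a b t)))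
               (cong (sumF (λ t → ind (p t ≟ r t)) +_) (ΣF.plus (miss a b) (λ t → dis (linePt a b t)))) ⟩
        sumF (λ t → ind (p t ≟ r t)) + (sumF (miss a b) + sumF (λ t → dis (linePt a b t)))
          ≤⟨ ℕₚ.+-monoˡ-≤ _ (ℕₚ.≤-pred (ℕₚ.≰⇒> nle)) ⟩
        d + (sumF (miss a b) + sumF (λ t → dis (linePt a b t))) ∎)
        where open ℕₚ.≤-Reasoning

  -- Combining the estimates

  V≡q′[q+1] : V ≡ q′ * suc (suc q′)
  V≡q′[q+1] = V-factor {V} {q′} (trans 1+V (sym (cong₂ _*_ 1+q′ 1+q′)))

  V-pos : 0 < V
  V-pos = subst (0 <_) (sym V≡q′[q+1]) (ℕₚ.*-mono-≤ 1≤q′ (s≤s z≤n))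

  dis+agree : ∀ Q → sumPt (dis Q) + agreePlane f Q ≡ q * q
  dis+agree Q = begin
    sumPt (dis Q) + sumPt (λ p → ind (f p ≟ evalB Q p))   ≡⟨ ℕₚ.+-comm (sumPt (dis Q)) _ ⟩
    sumPt (λ p → ind (f p ≟ evalB Q p)) + sumPt (dis Q)   ≡⟨ sym (ΣP.plus (λ p → ind (f p ≟ evalB Q p)) (dis Q)) ⟩
    sumPt (λ p → ind (f p ≟ evalB Q p) + dis Q p)         ≡⟨ ΣP.congr (λ p → ind-¬ (f p ≟ evalB Q p)) ⟩
    sumPt (λ _ → 1)                                       ≡⟨ trans (sumPt-const 1) (ℕₚ.*-identityʳ _) ⟩
    q * q                                                 ∎
    where open ≡-Reasoning

  -- Sums c e ≤ c r + e² over all parametrizations, where r counts the misses and e the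
  -- disagreements with Q on the line. On each line this is `min-quadratic` applied to the
  -- dichotomy; c stands for q - d.
  moments : ∀ (Q : BiPoly) c → c + d ≡ q → let M = sumPt (dis Q) in
    c * (q * (V * M)) ≤ c * (q * Rej) + q * (V * M + q′ * (M * M ∸ M))
  moments Q c c+d = begin
    c * (q * (V * M))                                              ≡⟨ cong (c *_) (sym (first-moment m m²)) ⟩
    c * sumPt (λ a → sumPt (λ b → nz b * e a b))                   ≡⟨ sym (scale₂ c (λ a b → nz b * e a b)) ⟩
    sumPt (λ a → sumPt (λ b → c * (nz b * e a b)))                 ≤⟨ ΣP.mono (λ a → ΣP.mono (λ b → line a b)) ⟩
    sumPt (λ a → sumPt (λ b → c * sumF (err a b) + nz b * (e a b * e a b)))
      ≡⟨ trans (ΣP.congr (λ a → ΣP.plus (λ b → c * sumF (err a b)) (λ b → nz b * (e a b * e a b))))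
           (ΣP.plus (λ a → sumPt (λ b → c * sumF (err a b))) (λ a → sumPt (λ b → nz b * (e a b * e a b)))) ⟩
    sumPt (λ a → sumPt (λ b → c * sumF (err a b))) + sumPt (λ a → sumPt (λ b → nz b * (e a b * e a b)))
      ≡⟨ cong₂ _+_ (trans (scale₂ c (λ a b → sumF (err a b))) (cong (c *_) sum-sum-err)) (second-moment m m²) ⟩
    c * (q * Rej) + q * (V * M + q′ * (M * M ∸ M))                 ∎
    where
    open ℕₚ.≤-Reasoning
    m : Pt → ℕ
    m = dis Q
    m² : ∀ p → m p * m p ≡ m p
    m² p = ind² (¬? (f p ≟ evalB Q p))
    M : ℕ
    M = sumPt m
    e : Pt → Pt → ℕ
    e a b = sumF (λ t → m (linePt a b t))
    scale₂ : ∀ k (g : Pt → Pt → ℕ) → sumPt (λ a → sumPt (λ b → k * g a b)) ≡ k * sumPt (λ a → sumPt (g a))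
    scale₂ k g = trans (ΣP.congr (λ a → ΣP.scale k (g a))) (ΣP.scale k (λ a → sumPt (g a)))
    dichotomy : ∀ a b → sumF (miss a b) ≡ e a b ⊎ c ≤ sumF (miss a b) + e a b
    dichotomy a b with line-dichotomy Q a b
    ... | inj₁ eq = inj₁ eq
    ... | inj₂ le = inj₂ (ℕₚ.+-cancelˡ-≤ d c _ (ℕₚ.≤-trans (ℕₚ.≤-reflexive (trans (ℕₚ.+-comm d c) c+d)) le))
    line : ∀ a b → c * (nz b * e a b) ≤ c * sumF (err a b) + nz b * (e a b * e a b)
    line a b = begin
      c * (nz b * e a b)                                              ≡⟨ l₁ c (nz b) (e a b) ⟩
      nz b * (c * e a b)                                              ≤⟨ ℕₚ.*-monoʳ-≤ (nz b) (min-quadratic c (sumF (miss a b)) (e a b) (dichotomy a b)) ⟩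
      nz b * (c * sumF (miss a b) + e a b * e a b)                    ≡⟨ l₂ (nz b) c (sumF (miss a b)) (e a b * e a b) ⟩
      c * (nz b * sumF (miss a b)) + nz b * (e a b * e a b)           ≡⟨ cong (λ z → c * z + nz b * (e a b * e a b)) (sym (ΣF.scale (nz b) (miss a b))) ⟩
      c * sumF (err a b) + nz b * (e a b * e a b)                     ∎
      where
      open import Data.Nat.Tactic.RingSolver using (solve-∀)
      l₁ : ∀ c n e → c * (n * e) ≡ n * (c * e)
      l₁ = solve-∀
      l₂ : ∀ n c r x → n * (c * r + x) ≡ c * (n * r) + n * x
      l₂ = solve-∀

  -- The crude bound of about V/5 on the disagreements makes the second moment at most c/2 times the
  -- first. Half of the first moment is then bounded by the rejections alone, so the crude constant
  -- disappears from the conclusion.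
  sharpen : ∀ (Q : BiPoly) T → 150 * d < q → sumPt (dis Q) ≤ 1 + T → 5 * T ≤ V → V * sumPt (dis Q) ≤ 2 * Rej
  sharpen Q T 150d<q close small = final-bound c q′ V (sumPt (dis Q)) Rej {{c≢0}} V≡q′[q+1]
      (subst (λ x → c * (x * (V * M)) ≤ c * (x * Rej) + x * (V * M + q′ * (M * M ∸ M))) (sym 1+q′) (moments Q c c+d))
      (slack {d} {q′} {c} {V} {M} {T} (trans c+d (sym 1+q′)) (subst (150 * d <_) (sym 1+q′) 150d<q) 1≤q′ V≡q′[q+1] close small)
    where
    M : ℕ
    M = sumPt (dis Q)
    c : ℕ
    c = q ∸ d
    d<q : d < q
    d<q = ℕₚ.≤-<-trans (ℕₚ.m≤m+n d (149 * d)) 150d<q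
    c+d : c + d ≡ q
    c+d = ℕₚ.m∸n+n≡m (ℕₚ.<⇒≤ d<q)
    c≢0 : NonZero c
    c≢0 = >-nonZero (ℕₚ.m<n⇒0<n∸m d<q)

  counting : 150 * d < q → 100 * Rej ≤ q * q * V → ∃ λ (Q : BiPoly) → V * sumPt (dis Q) ≤ 2 * Rej
  counting 150d<q few-rej = proj₁ Q , sharpen (proj₁ Q) (Ce.T (proj₁ a)) 150d<q (proj₂ Q) T≤
    where
    q≢0 : 0 < q
    q≢0 = ℕₚ.≤-trans (s≤s z≤n) 2≤q
    β : ∃ λ (β : Pt) → ¬ proj₂ β ≡ 0# × q * q′ * sumPt (λ a → rej a β) ≤ Rej
    β = good-direction
    ẽ : ∃ λ e → 5 * e ≤ 3 * q × 3 * q < 5 * suc e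
    ẽ = three-fifths q
    e : ℕ
    e = proj₁ ẽ
    module Pa = Parameters d q e 150d<q (proj₁ (proj₂ ẽ)) (proj₂ (proj₂ ẽ))
    module In = Interpolation e Pa.s (λ x → P (x , 0#) (proj₁ β)) Pa.few Pa.s<q Pa.e<q
    module Co = Columns (proj₁ β) (proj₁ (proj₂ β)) e Pa.s In.E In.N In.equation In.nonvanishing
    module Ce = Centre (proj₁ β) (λ z → proj₁ (proj₂ β) (cong proj₂ z)) (e + Pa.s) Co.E Co.N Co.E-Deg Co.N-Deg Co.agree
    Rβ : ℕ
    Rβ = sumPt (λ a → rej a (proj₁ β))
    NZ-big : 19 * (q * q) ≤ 50 * Ce.NZ
    NZ-big = Pa.NZ-large {Ce.NZ} Co.NZ-bound
    NZ-pos : 0 < Ce.NZ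
    NZ-pos = ℕₚ.*-cancelˡ-< 50 0 Ce.NZ (ℕₚ.≤-trans (ℕₚ.≤-trans (s≤s z≤n) (ℕₚ.*-monoʳ-≤ 19 (ℕₚ.*-mono-≤ q≢0 q≢0))) NZ-big)
    a : ∃ λ a → ¬ Co.E a ≡ 0# × Ce.NZ * Ce.T a ≤ Rej + Ce.Z
    a = Ce.centre NZ-pos
    Q : ∃ λ (Q : BiPoly) → sumPt (dis Q) ≤ 1 + Ce.T (proj₁ a)
    Q = Ce.approximation (proj₁ a) (proj₁ (proj₂ a))
    Z≤ : 19 * Ce.Z ≤ 50 * (Rej + V * Rβ)
    Z≤ = Pa.Z-small {Ce.Z} {Rej + V * Rβ} (ℕₚ.≤-trans Ce.Z-bound (ℕₚ.≤-reflexive (cong (Ce.h * Ce.Z +_) (sym (ℕₚ.*-distribˡ-+ q Rej (V * Rβ))))))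
    X≤ : 2 * (Rej + V * Rβ) ≤ 5 * Rej
    X≤ = X-small {q′} {V} {Rβ} {Rej} 1≤q′ V≡q′[q+1] (subst (λ x → x * q′ * Rβ ≤ Rej) (sym 1+q′) (proj₂ (proj₂ β)))
    T≤ : 5 * Ce.T (proj₁ a) ≤ V
    T≤ = T-small {q * q} {V} {Rej} {Rej + V * Rβ} {Ce.Z} {Ce.NZ} {Ce.T (proj₁ a)} {{>-nonZero (ℕₚ.*-mono-≤ q≢0 q≢0)}} few-rej X≤ Z≤ NZ-big (proj₂ (proj₂ a))

-- The theorem in terms of probabilities

open import Data.Nat using (_*_; _<_)
open import Data.Integer using (+_)
open import Data.Product using (∃; _×_; _,_)
open import Data.Rational using (ℚ; _/_; _-_; _≤_) renaming (_*_ to _*ℚ_; _<_ to _<ℚ_)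

theorem4p5 : ∃ λ (C : ℕ) → ∀ (F : FiniteField) (d : ℕ) → C * d < FiniteField.size F →
    ∀ (δ : ℚ) → δ <ℚ (+ 1 / 100) →
    ∀ (f : LDT.Pt F d → FiniteField.Carrier F) (B : LDT.BestFit F d f) →
    (toℚ 1 - δ) *ℚ toℚ (LDT.ldtTotal F d f) ≤ toℚ (LDT.ldtAccept F d f B) →
    ∃ λ (Q : LDT.BiPoly F d) →
      (toℚ 1 - toℚ 2 *ℚ δ) *ℚ toℚ (LDT.q F d * LDT.q F d) ≤ toℚ (LDT.agreePlane F d f Q)
theorem4p5 = 150 , λ F d 150d<q δ δ<1/100 f B accepted →
  let open Plane F d
      open Test F d f B
      rejected = complement-≤ δ Rej (ldtAccept f B) (ldtTotal f) Rej+accept accepted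
      Q , close = counting 150d<q (≤-trans (hundredth δ Rej (ldtTotal f) δ<1/100 rejected) (≤-reflexive (cong (q * q *_) (sym V≡))))
  in Q , complement-≥ (toℚ 2 *ℚ δ) (sumPt (dis Q)) (agreePlane f Q) (q * q) (dis+agree Q)
       (double-bound δ (sumPt (dis Q)) Rej (q * q) V V-pos close (subst (λ v → toℚ Rej ≤ δ *ℚ toℚ (q * q * v)) (sym V≡) rejected))
  where
  open import Data.Nat.Properties using (≤-trans; ≤-reflexive)
  open import Relation.Binary.PropositionalEquality using (cong; sym; subst)
  open Rationals
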